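{- For all $n \geq 29$, \[\mathrm{ex}_o(n,R_4) = \left\lfloor \frac{n}{3} \right\rfloor \binom{\lceil 2n/3 \rceil}{2},\] and for all $n \geq 70$, \[\mathrm{ex}(n,R_4) = \left\lfloor \frac{n}{3} \right\rfloor \binom{\lceil 2n/3 \rceil}{2}.\] Moreover, in each case (oriented and standard) the extremal graphs, i.e. the $R_4$-free graphs on $n$ vertices attaining this number of edges, are unique up to isomorphism when $n \equiv 0,1 \pmod 3$, and there are exactly two of them up to isomorphism when $n \equiv 2 \pmod 3$.
   Context: A $2\to1$ directed hypergraph (here simply a "graph") is a pair $H=(V,E)$ with $V$ a finite vertex set and $E$ a set of edges, each edge being a 3-element subset $\{a,b,c\}$ of $V$ with one element marked as the head; the edge with underlying set $\{a,b,c\}$ and head $c$ is written $ab \to c$ (and $\{a,b\}$ is its tail set). A triple may carry up to three distinct edges (one for each choice of head). $H$ is oriented if every 3-subset of $V$ carries at most one edge. A homomorphism $\phi:F\to G$ is a map $V(F)\to V(G)$ with $ab\to c\in E(F)\Rightarrow \phi(a)\phi(b)\to\phi(c)\in E(G)$. $G$ is $F$-free if there is no injective homomorphism $F\to G$. $\mathrm{ex}(n,F)$ is the maximum number of edges of an $F$-free graph on $n$ vertices, and $\mathrm{ex}_o(n,F)$ is the maximum number of edges of an $F$-free oriented graph on $n$ vertices. $R_4$ is the graph with vertex set $\{a,b,c,d,e\}$ and edge set $\{ab\to c,\ cd\to e\}$. -}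

module Defs where

open import Data.Nat using (ℕ; zero; suc; _+_; _*_; _≤_; _<ᵇ_)
open import Data.Nat.DivMod using (_/_; _%_)
open import Data.Nat.Combinatorics using (_C_)
open import Data.Bool using (Bool; true; false; _∧_; if_then_else_)
open import Data.Fin using (Fin; zero; suc; toℕ)
open import Data.List using (List; map; allFin)
open import Data.Nat.ListAction using (sum)
open import Data.Product using (Σ; _×_; _,_)
open import Data.Sum using (_⊎_)
open import Relation.Nullary using (¬_)
open import Relation.Binary.PropositionalEquality using (_≡_; _≢_)
open import Function.Definitions using (Injective)
open import Function.Bundles using (_↔_; Inverse)

-- A (raw) 2→1 directed hypergraph on vertex set Fin n:
-- E a b c ≡ true  means the edge  ab → c  (tail {a,b}, head c) is present.
Raw : ℕ → Set
Raw n = Fin n → Fin n → Fin n → Bool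

record IsGraph {n : ℕ} (E : Raw n) : Set where
  field
    distinct : ∀ a b c → E a b c ≡ true → (a ≢ b) × (a ≢ c) × (b ≢ c)
    tailSym  : ∀ a b c → E a b c ≡ E b a c

Oriented : {n : ℕ} → Raw n → Set
Oriented E = ∀ a b c → E a b c ≡ true → (E a c b ≡ false) × (E b c a ≡ false)

-- Number of edges: each edge ab → c is counted once, via toℕ a < toℕ b.
edgeCount : {n : ℕ} → Raw n → ℕ
edgeCount {n} E =
  sum (map (λ a → sum (map (λ b → sum (map (λ c →
    if (toℕ a <ᵇ toℕ b) ∧ E a b c then 1 else 0)
    (allFin n))) (allFin n))) (allFin n))

IsHom : {m n : ℕ} → Raw m → Raw n → (Fin m → Fin n) → Set
IsHom F G φ = ∀ a b c → F a b c ≡ true → G (φ a) (φ b) (φ c) ≡ true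

Free : {m n : ℕ} → Raw m → Raw n → Set
Free F G = ¬ (Σ (Fin _ → Fin _) (λ φ → Injective _≡_ _≡_ φ × IsHom F G φ))

-- R₄ on vertices a=0, b=1, c=2, d=3, e=4 with edges ab → c and cd → e
-- (both orderings of each tail are listed, since tails are unordered).
R4 : Raw 5
R4 zero (suc zero) (suc (suc zero)) = true
R4 (suc zero) zero (suc (suc zero)) = true
R4 (suc (suc zero)) (suc (suc (suc zero))) (suc (suc (suc (suc zero)))) = true
R4 (suc (suc (suc zero))) (suc (suc zero)) (suc (suc (suc (suc zero)))) = true
R4 _ _ _ = false

R4FreeGraph : (n : ℕ) → Raw n → Set
R4FreeGraph n E = IsGraph E × Free R4 E

R4FreeOriented : (n : ℕ) → Raw n → Set
R4FreeOriented n E = IsGraph E × Oriented E × Free R4 E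

Iso : {n : ℕ} → Raw n → Raw n → Set
Iso {n} G H = Σ (Fin n ↔ Fin n) (λ σ →
  ∀ a b c → G a b c ≡ H (Inverse.to σ a) (Inverse.to σ b) (Inverse.to σ c))

IsExtremalNumber : {n : ℕ} → (Raw n → Set) → ℕ → Set
IsExtremalNumber {n} P N =
  Σ (Raw n) (λ G → P G × edgeCount G ≡ N) × (∀ G → P G → edgeCount G ≤ N)

Extremal : {n : ℕ} → (Raw n → Set) → ℕ → Raw n → Set
Extremal P N G = P G × edgeCount G ≡ N

UniqueUpToIso : {n : ℕ} → (Raw n → Set) → Set
UniqueUpToIso {n} Q = Σ (Raw n) (λ G → Q G × (∀ H → Q H → Iso G H))

ExactlyTwoUpToIso : {n : ℕ} → (Raw n → Set) → Set
ExactlyTwoUpToIso {n} Q = Σ (Raw n) (λ G₁ → Σ (Raw n) (λ G₂ →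
  Q G₁ × Q G₂ × ¬ Iso G₁ G₂ × (∀ H → Q H → Iso G₁ H ⊎ Iso G₂ H)))

-- ⌊n/3⌋ · C(⌈2n/3⌉, 2), with ⌈2n/3⌉ = ⌊(2n+2)/3⌋.
bound : ℕ → ℕ
bound n = (n / 3) * (((2 * n + 2) / 3) C 2)

ExtremalResult : (n : ℕ) → (Raw n → Set) → Set
ExtremalResult n P =
  IsExtremalNumber P (bound n) ×
  ((n % 3 ≢ 2) → UniqueUpToIso (Extremal P (bound n))) ×
  ((n % 3 ≡ 2) → ExactlyTwoUpToIso (Extremal P (bound n)))

{-# OPTIONS --safe #-}

-- R₄-freeness says that, at every vertex x, each head pair ab (with ab → x) meets each tail pair
-- de (with xd → e).  Hence a vertex that is both a head and a tail lies in only linearly many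
-- edges: at most 2n in the oriented and 5n in the standard case.  If t vertices are never heads,
-- h are heads but never tails, and m are both, then the number of edges is at most
-- h · C(t,2) + m · c with c = 2n or c = 5n.  The first term is at most bound (n − m).  Since bound
-- is convex, the total stays below bound n for all m > 0 if it does so for m = 1 and m = n, which
-- is the case from n = 29 and n = 70 on.  For m = 0, equality forces all edges from pairs of
-- never-heads to the other vertices, and h · C(n − h, 2) is unimodal in h with maximum at ⌊n/3⌋,
-- tied with ⌊n/3⌋ + 1 exactly when n ≡ 2 (mod 3).
module Submission where

open import Defs
open import Data.Nat using (ℕ; zero; suc; pred; _+_; _*_; _∸_; _≤_; _<_; _<ᵇ_; _≤′_; ≤′-refl; ≤′-step; z≤n; s≤s)
open import Data.Nat.Properties
open import Data.Nat.Combinatorics using (_C_; nC1≡n; nCk+nC[k+1]≡[n+1]C[k+1])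
open import Data.Nat.DivMod using (_/_; _%_; m≡m%n+[m/n]*n; [m+kn]%n≡m%n; m<n⇒m%n≡m)
open import Data.Nat.Tactic.RingSolver using (solve-∀)
import Data.Nat.ListAction as List
open import Algebra.Properties.Semiring.Sum +-*-semiring using (sum; sum-syntax; sum-cong-≗; sum-remove; sum-permute; ∑-distrib-+; ∑-comm; *-distribʳ-sum; *-distribˡ-sum)
open import Data.Bool using (Bool; true; false; not; _∧_; if_then_else_)
open import Data.Bool.Properties using () renaming (_≟_ to _≟ᵇ_)
open import Data.Empty using (⊥-elim)
open import Data.Fin using (Fin; zero; suc; toℕ; punchIn)
open import Data.Fin.Patterns using (0F; 1F; 2F; 3F; 4F)
open import Data.Fin.Permutation using (Permutation; _⟨$⟩ʳ_; insert; insert-punchIn) renaming (id to idₚ)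
open import Data.Fin.Properties using (any?; all?) renaming (_≟_ to _≟ᶠ_)
open import Data.List using (map; allFin; tabulate)
open import Data.List.Properties using (map-tabulate)
open import Data.Product using (∃; Σ; _×_; _,_; proj₁; proj₂)
open import Data.Sum using (_⊎_; inj₁; inj₂; swap)
open import Data.Vec using (lookup; []; _∷_)
import Data.Vec.Relation.Unary.All as All
import Data.Vec.Relation.Unary.AllPairs as AllPairs
open import Data.Vec.Relation.Unary.Unique.Propositional using (Unique)
open import Data.Vec.Relation.Unary.Unique.Propositional.Properties using (lookup-injective)
open import Function using (_∘_; id)
open import Function.Bundles using (Injection)
open import Function.Definitions using (Injective)
open import Function.Properties.Inverse using (↔⇒↣)
open import Relation.Binary.Definitions using (tri<; tri≈; tri>)
open import Relation.Binary.PropositionalEquality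
open import Relation.Nullary using (¬_; Dec; yes; no; does; contradiction)
open import Relation.Nullary.Decidable using (from-yes; dec-true; _×-dec_; _⊎-dec_; _→-dec_; ¬?)

-- Maximising h · C(t,2) for fixed h + t

-- Nothing limits the number of mixed vertices in advance, so the estimate must hold for every m at
-- once; this is what convexity is for. The leading term of `bound n` is 2n³/27. A graph with only
-- mixed vertices has at most n·c edges, which is below this for n > 27 if c = 2n and for n > 67.5
-- if c = 5n, and lower-order terms move the starting points to 29 and 70. Just before, the
-- comparison fails: n = 28 gives 1568 against 1539, and n = 69 gives 23805 on both sides. The
-- condition for m = 1 compares c with the last increment of `bound`, about 2n²/9, and is the milder
-- one. Links are measured in ordered pairs, so each edge counts twice and bounds carry a factor 2.
-- To bound a link, its indicator is majorised by rows, columns and cells of the n × n grid, whose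
-- totals are explicit.

C2-suc : ∀ t → suc t C 2 ≡ t + t C 2
C2-suc t = trans (sym (nCk+nC[k+1]≡[n+1]C[k+1] t 1)) (cong (_+ t C 2) (nC1≡n t))

C2-double : ∀ t → 2 * (t C 2) + t ≡ t * t
C2-double zero = refl
C2-double (suc t) = begin
  2 * (suc t C 2) + suc t   ≡⟨ cong (λ c → 2 * c + suc t) (C2-suc t) ⟩
  2 * (t + t C 2) + suc t   ≡⟨ regroup t (t C 2) ⟩
  (2 * (t C 2) + t) + suc (t + t)   ≡⟨ cong (_+ suc (t + t)) (C2-double t) ⟩
  t * t + suc (t + t)       ≡⟨ square t ⟩
  suc t * suc t             ∎
  where
  open ≡-Reasoning
  regroup : ∀ t c → 2 * (t + c) + suc t ≡ (2 * c + t) + suc (t + t)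
  regroup = solve-∀
  square : ∀ t → t * t + suc (t + t) ≡ suc t * suc t
  square = solve-∀

odd-multiple : ∀ h t → suc (2 * h) * t ≡ 2 * (h * t) + t
odd-multiple = solve-∀

-- Since 2·C(t,2) = t·(t - 1), comparing C(t,2) with h·t amounts to comparing t - 1 with 2h.
≤C2 : ∀ h t → suc (2 * h) ≤ t → h * t ≤ t C 2
≤C2 h t p = *-cancelˡ-≤ 2 (+-cancelʳ-≤ t _ _
  (subst₂ _≤_ (odd-multiple h t) (sym (C2-double t)) (*-monoˡ-≤ t p)))

<C2 : ∀ h t → suc (2 * h) < t → h * t < t C 2
<C2 h t@(suc _) p = *-cancelˡ-< 2 _ _ (+-cancelʳ-< t _ _
  (subst₂ _<_ (odd-multiple h t) (sym (C2-double t)) (*-monoˡ-< t p)))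

C2≤ : ∀ h t → t ≤ suc (2 * h) → t C 2 ≤ h * t
C2≤ h t p = *-cancelˡ-≤ 2 (+-cancelʳ-≤ t _ _
  (subst₂ _≤_ (sym (C2-double t)) (odd-multiple h t) (*-monoˡ-≤ t p)))

C2< : ∀ h t → 0 < t → t < suc (2 * h) → t C 2 < h * t
C2< h t@(suc _) _ p = *-cancelˡ-< 2 _ _ (+-cancelʳ-< t _ _
  (subst₂ _<_ (sym (C2-double t)) (odd-multiple h t) (*-monoˡ-< t p)))

h*C2-suc : ∀ h t → h * (suc t C 2) ≡ h * t + h * (t C 2)
h*C2-suc h t = trans (cong (h *_) (C2-suc t)) (*-distribˡ-+ h t (t C 2))

-- Moving one vertex from the tail class to the head class changes the product by C(t,2) - h·t,
-- where t is the size of the tail class after the move. The turning point is t = 2h + 1.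
step-up : ∀ h t → suc (2 * h) ≤ t → h * (suc t C 2) ≤ suc h * (t C 2)
step-up h t p = subst (_≤ suc h * (t C 2)) (sym (h*C2-suc h t)) (+-monoˡ-≤ _ (≤C2 h t p))

step-up-< : ∀ h t → suc (2 * h) < t → h * (suc t C 2) < suc h * (t C 2)
step-up-< h t p = subst (_< suc h * (t C 2)) (sym (h*C2-suc h t)) (+-monoˡ-< _ (<C2 h t p))

step-down : ∀ h t → t ≤ suc (2 * h) → suc h * (t C 2) ≤ h * (suc t C 2)
step-down h t p = subst (suc h * (t C 2) ≤_) (sym (h*C2-suc h t)) (+-monoˡ-≤ _ (C2≤ h t p))

step-down-< : ∀ h t → 0 < t → t < suc (2 * h) → suc h * (t C 2) < h * (suc t C 2)
step-down-< h t 0<t p = subst (suc h * (t C 2) <_) (sym (h*C2-suc h t)) (+-monoˡ-< _ (C2< h t 0<t p))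

2*suc : ∀ h → 2 * suc h ≡ suc (suc (2 * h))
2*suc = solve-∀

-- Each step raises h and lowers t, so the last step has the least room, and a hypothesis on the
-- final sizes covers all of them.
climb-up : ∀ d h t → 2 * (d + h) ≤ suc t → h * ((d + t) C 2) ≤ (d + h) * (t C 2)
climb-up zero h t p = ≤-refl
climb-up (suc d) h t p = begin
  h * ((suc d + t) C 2)     ≡⟨ cong (λ s → h * (s C 2)) (sym (+-suc d t)) ⟩
  h * ((d + suc t) C 2)     ≤⟨ climb-up d h (suc t) (≤-trans (m≤n+m _ 2) (≤-trans room (n≤1+n _))) ⟩
  (d + h) * (suc t C 2)     ≤⟨ step-up (d + h) t (≤-pred room) ⟩
  (suc d + h) * (t C 2)     ∎
  where
  open ≤-Reasoning
  room : suc (suc (2 * (d + h))) ≤ suc t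
  room = subst (_≤ suc t) (2*suc (d + h)) p

climb-down : ∀ d h t → d + t ≤ suc (suc (2 * h)) → (d + h) * (t C 2) ≤ h * ((d + t) C 2)
climb-down zero h t p = ≤-refl
climb-down (suc d) h t p = begin
  (suc d + h) * (t C 2)     ≡⟨ cong (_* (t C 2)) (sym (+-suc d h)) ⟩
  (d + suc h) * (t C 2)     ≤⟨ climb-down d (suc h) t
    (≤-trans d+t≤ (≤-trans (m≤n+m _ 3) (≤-reflexive (cong (λ z → suc (suc z)) (sym (2*suc h)))))) ⟩
  suc h * ((d + t) C 2)     ≤⟨ step-down h (d + t) d+t≤ ⟩
  h * ((suc d + t) C 2)     ∎
  where
  open ≤-Reasoning
  d+t≤ : d + t ≤ suc (2 * h)
  d+t≤ = ≤-pred p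

optimum-below : ∀ h t h′ t′ → h + t ≡ h′ + t′ → h < h′ → 2 * h′ ≤ t′ →
                h * (t C 2) < h′ * (t′ C 2)
optimum-below h t h′ t′ eq h<h′ p with m≤n⇒∃[o]m+o≡n h<h′
... | d , refl = subst₂ (λ s g → h * (s C 2) < g * (t′ C 2)) s≡ (cong suc (+-comm d h)) gain
  where
  open ≤-Reasoning
  s≡ : d + suc t′ ≡ t
  s≡ = +-cancelˡ-≡ h _ _ (trans (rearr h d t′) (sym eq))
    where
    rearr : ∀ h d t → h + (d + suc t) ≡ suc (h + d) + t
    rearr = solve-∀
  room : suc (suc (2 * (d + h))) ≤ t′
  room = subst (_≤ t′) (trans (2*suc (h + d)) (cong (λ z → suc (suc (2 * z))) (+-comm h d))) p
  gain : h * ((d + suc t′) C 2) < (suc d + h) * (t′ C 2)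
  gain = begin-strict
    h * ((d + suc t′) C 2)     ≤⟨ climb-up d h (suc t′) (≤-trans (m≤n+m _ 2) (≤-trans room (m≤n+m _ 2))) ⟩
    -- Strictness is gained in the last step only; the earlier ones may be weak.
    (d + h) * (suc t′ C 2)     <⟨ step-up-< (d + h) t′ room ⟩
    (suc d + h) * (t′ C 2)     ∎

-- At t′ = 1 both products vanish, hence the demand `2 ≤ t′`: it leaves a nonempty tail class in the
-- strict last step.
optimum-above : ∀ h t h′ t′ → h + t ≡ h′ + t′ → h′ < h → t′ ≤ suc (2 * h′) → 2 ≤ t′ →
                h * (t C 2) < h′ * (t′ C 2)
optimum-above h t h′ t′ eq h′<h p 2≤t′ with m≤n⇒∃[o]m+o≡n h′<h
... | d , refl = subst₂ (λ g s → g * (t C 2) < h′ * (s C 2)) h≡ s≡ gain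
  where
  open ≤-Reasoning
  s≡ : suc (d + t) ≡ t′
  s≡ = +-cancelˡ-≡ h′ _ _ (trans (rearr h′ d t) eq)
    where
    rearr : ∀ h d t → h + suc (d + t) ≡ suc (h + d) + t
    rearr = solve-∀
  h≡ : d + suc h′ ≡ suc (h′ + d)
  h≡ = trans (+-suc d h′) (cong suc (+-comm d h′))
  room : d + t < suc (2 * h′)
  room = subst (_≤ suc (2 * h′)) (sym s≡) p
  gain : (d + suc h′) * (t C 2) < h′ * (suc (d + t) C 2)
  gain = begin-strict
    (d + suc h′) * (t C 2)   ≤⟨ climb-down d (suc h′) t
      (≤-trans (<⇒≤ room) (≤-trans (m≤n+m _ 3) (≤-reflexive (cong (λ z → suc (suc z)) (sym (2*suc h′)))))) ⟩
    suc h′ * ((d + t) C 2)   <⟨ step-down-< h′ (d + t) (≤-pred (subst (2 ≤_) (sym s≡) 2≤t′)) room ⟩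
    h′ * (suc (d + t) C 2)   ∎

-- Residues modulo 3 and the convexity of `bound`

data Mod3 : ℕ → Set where
  0mod3 : ∀ k → Mod3 (3 * k)
  1mod3 : ∀ k → Mod3 (1 + 3 * k)
  2mod3 : ∀ k → Mod3 (2 + 3 * k)

mod3 : ∀ n → Mod3 n
mod3 zero = 0mod3 0
mod3 (suc n) with mod3 n
... | 0mod3 k = 1mod3 k
... | 1mod3 k = 2mod3 k
... | 2mod3 k = subst Mod3 (*-suc 3 k) (0mod3 (suc k))

%3 : ∀ r k → r < 3 → (r + 3 * k) % 3 ≡ r
%3 r k r<3 = trans (cong (λ z → (r + z) % 3) (*-comm 3 k))
                   (trans ([m+kn]%n≡m%n r k 3) (m<n⇒m%n≡m r<3))

/3 : ∀ r k → r < 3 → (r + 3 * k) / 3 ≡ k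
/3 r k r<3 = sym (*-cancelʳ-≡ k _ 3 (+-cancelˡ-≡ r _ _
  (trans (cong (r +_) (*-comm k 3)) (trans (m≡m%n+[m/n]*n (r + 3 * k) 3)
    (cong (_+ (r + 3 * k) / 3 * 3) (%3 r k r<3))))))

-- Dividing 2n + 2 = s + 3q by 3 identifies q as ⌈2n/3⌉, so each residue class needs only one linear
-- identity.
bound-form : ∀ r s k q → r < 3 → s < 3 → 2 * (r + 3 * k) + 2 ≡ s + 3 * q →
             bound (r + 3 * k) ≡ k * (q C 2)
bound-form r s k q r<3 s<3 eq = cong₂ (λ x y → x * (y C 2)) (/3 r k r<3)
  (trans (cong (_/ 3) eq) (/3 s q s<3))

bound-0 : ∀ k → bound (3 * k) ≡ k * ((2 * k) C 2)
bound-0 k = bound-form 0 2 k (2 * k) (s≤s z≤n) ≤-refl (eq k)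
  where
  eq : ∀ k → 2 * (3 * k) + 2 ≡ 2 + 3 * (2 * k)
  eq = solve-∀

bound-1 : ∀ k → bound (1 + 3 * k) ≡ k * (suc (2 * k) C 2)
bound-1 k = bound-form 1 1 k (suc (2 * k)) (s≤s (s≤s z≤n)) (s≤s (s≤s z≤n)) (eq k)
  where
  eq : ∀ k → 2 * (1 + 3 * k) + 2 ≡ 1 + 3 * suc (2 * k)
  eq = solve-∀

bound-2 : ∀ k → bound (2 + 3 * k) ≡ k * (suc (suc (2 * k)) C 2)
bound-2 k = bound-form 2 0 k (suc (suc (2 * k))) ≤-refl (s≤s z≤n) (eq k)
  where
  eq : ∀ k → 2 * (2 + 3 * k) + 2 ≡ 0 + 3 * suc (suc (2 * k))
  eq = solve-∀

C2-even : ∀ k → (2 * k) C 2 + k ≡ 2 * (k * k)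
C2-even k = *-cancelˡ-≡ _ _ 2 (begin
  2 * ((2 * k) C 2 + k)        ≡⟨ *-distribˡ-+ 2 ((2 * k) C 2) k ⟩
  2 * ((2 * k) C 2) + 2 * k    ≡⟨ C2-double (2 * k) ⟩
  2 * k * (2 * k)              ≡⟨ square k ⟩
  2 * (2 * (k * k))            ∎)
  where
  open ≡-Reasoning
  square : ∀ k → 2 * k * (2 * k) ≡ 2 * (2 * (k * k))
  square = solve-∀

-- The forward difference of `bound`. Starting from k heads and t tails, a new vertex among the
-- tails adds k·t edges and one among the heads adds C(t,2). The former happens for residues 0 and
-- 1, the latter for residue 2, where C(2k+2,2) = (k+1)(2k+1).
Δ′ : ∀ {n} → Mod3 n → ℕ
Δ′ (0mod3 k) = k * (2 * k)
Δ′ (1mod3 k) = k * suc (2 * k)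
Δ′ (2mod3 k) = suc k * suc (2 * k)

Δ : ℕ → ℕ
Δ n = Δ′ (mod3 n)

C2-even′ : ∀ k → suc (suc (2 * k)) C 2 ≡ suc k * suc (2 * k)
C2-even′ k = +-cancelʳ-≡ k _ _ (begin
  suc (suc (2 * k)) C 2 + k                       ≡⟨ cong (_+ k) (C2-suc (suc (2 * k))) ⟩
  suc (2 * k) + suc (2 * k) C 2 + k               ≡⟨ cong (λ z → suc (2 * k) + z + k) (C2-suc (2 * k)) ⟩
  suc (2 * k) + (2 * k + (2 * k) C 2) + k         ≡⟨ regroup k ((2 * k) C 2) ⟩
  suc (2 * k) + 2 * k + ((2 * k) C 2 + k)         ≡⟨ cong (suc (2 * k) + 2 * k +_) (C2-even k) ⟩
  suc (2 * k) + 2 * k + 2 * (k * k)               ≡⟨ expand k ⟩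
  suc k * suc (2 * k) + k                         ∎)
  where
  open ≡-Reasoning
  regroup : ∀ k c → suc (2 * k) + (2 * k + c) + k ≡ suc (2 * k) + 2 * k + (c + k)
  regroup = solve-∀
  expand : ∀ k → suc (2 * k) + 2 * k + 2 * (k * k) ≡ suc k * suc (2 * k) + k
  expand = solve-∀

bound-suc : ∀ n → bound (suc n) ≡ bound n + Δ n
bound-suc n with mod3 n
... | 0mod3 k = begin
  bound (1 + 3 * k)                          ≡⟨ bound-1 k ⟩
  k * (suc (2 * k) C 2)                      ≡⟨ h*C2-suc k (2 * k) ⟩
  k * (2 * k) + k * ((2 * k) C 2)            ≡⟨ +-comm (k * (2 * k)) _ ⟩
  k * ((2 * k) C 2) + k * (2 * k)            ≡⟨ cong (_+ k * (2 * k)) (sym (bound-0 k)) ⟩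
  bound (3 * k) + k * (2 * k)                ∎
  where open ≡-Reasoning
... | 1mod3 k = begin
  bound (2 + 3 * k)                               ≡⟨ bound-2 k ⟩
  k * (suc (suc (2 * k)) C 2)                     ≡⟨ h*C2-suc k (suc (2 * k)) ⟩
  k * suc (2 * k) + k * (suc (2 * k) C 2)         ≡⟨ +-comm (k * suc (2 * k)) _ ⟩
  k * (suc (2 * k) C 2) + k * suc (2 * k)         ≡⟨ cong (_+ k * suc (2 * k)) (sym (bound-1 k)) ⟩
  bound (1 + 3 * k) + k * suc (2 * k)             ∎
  where open ≡-Reasoning
... | 2mod3 k = begin
  bound (3 + 3 * k)                               ≡⟨ cong bound (sym (*-suc 3 k)) ⟩
  bound (3 * suc k)                               ≡⟨ bound-0 (suc k) ⟩
  suc k * ((2 * suc k) C 2)                       ≡⟨ cong (λ z → suc k * (z C 2)) (2*suc k) ⟩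
  c + k * c                                       ≡⟨ +-comm c (k * c) ⟩
  k * c + c                                       ≡⟨ cong₂ _+_ (sym (bound-2 k)) (C2-even′ k) ⟩
  bound (2 + 3 * k) + suc k * suc (2 * k)         ∎
  where
  open ≡-Reasoning
  c = suc (suc (2 * k)) C 2

Δ-mono-suc : ∀ n → Δ n ≤ Δ (suc n)
Δ-mono-suc n with mod3 n
... | 0mod3 k = *-monoʳ-≤ k (n≤1+n (2 * k))
... | 1mod3 k = *-monoˡ-≤ (suc (2 * k)) (n≤1+n k)
-- Here `mod3` delivers its view of 3 + 3k inside a `subst`, which has to be removed before `Δ′`
-- computes. What remains is 2k + 1 ≤ 2k + 2.
... | 2mod3 k = subst (suc k * suc (2 * k) ≤_) (sym (Δ′-subst (*-suc 3 k) (0mod3 (suc k))))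
    (*-monoʳ-≤ (suc k) (≤-trans (n≤1+n _) (≤-reflexive (sym (2*suc k)))))
  where
  Δ′-subst : ∀ {m n} (eq : m ≡ n) (v : Mod3 m) → Δ′ (subst Mod3 eq v) ≡ Δ′ v
  Δ′-subst refl v = refl

Δ-mono : ∀ {m n} → m ≤′ n → Δ m ≤ Δ n
Δ-mono ≤′-refl = ≤-refl
Δ-mono {n = suc n} (≤′-step m≤n) = ≤-trans (Δ-mono m≤n) (Δ-mono-suc n)

-- By monotonicity of `Δ` all increments before n are at most c as well, and `bound` starts at 0.
bound≤linear : ∀ c n → Δ n ≤ c → bound n ≤ n * c
bound≤linear c zero _ = z≤n
bound≤linear c (suc n) Δ≤c = begin
  bound (suc n)    ≡⟨ bound-suc n ⟩
  bound n + Δ n    ≤⟨ +-mono-≤ (bound≤linear c n Δn≤c) Δn≤c ⟩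
  n * c + c        ≡⟨ +-comm (n * c) c ⟩
  suc n * c        ∎
  where
  open ≤-Reasoning
  Δn≤c : Δ n ≤ c
  Δn≤c = ≤-trans (Δ-mono-suc n) Δ≤c

linear≤bound : ∀ c j m → c ≤ Δ j → bound j + m * c ≤ bound (m + j)
linear≤bound c j zero _ = ≤-reflexive (+-identityʳ (bound j))
linear≤bound c j (suc m) c≤Δ = begin
  bound j + (c + m * c)      ≡⟨ regroup (bound j) c (m * c) ⟩
  bound j + m * c + c        ≤⟨ +-mono-≤ (linear≤bound c j m c≤Δ) (≤-trans c≤Δ (Δ-mono (≤⇒≤′ (m≤n+m j m)))) ⟩
  bound (m + j) + Δ (m + j)  ≡⟨ sym (bound-suc (m + j)) ⟩
  bound (suc m + j)          ∎
  where
  open ≤-Reasoning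
  regroup : ∀ x y z → x + (y + z) ≡ x + z + y
  regroup = solve-∀

-- By convexity of bound, the maximum over m is attained at m = 1 or at j = 0.
bound-gap : ∀ c m j → c < Δ (m + j) → (suc m + j) * c < bound (suc m + j) →
            bound j + suc m * c < bound (suc m + j)
-- If c ≤ `Δ j`, the mixed vertices can be traded one at a time for increments of `bound` without
-- loss, and the last trade gains. Otherwise all increments up to j are at most c, so `bound j` ≤
-- j·c and the estimate with only mixed vertices takes over.
bound-gap c m j c<Δ linear< with ≤-total c (Δ j)
... | inj₁ c≤Δ = begin-strict
  bound j + (c + m * c)      ≡⟨ regroup (bound j) c (m * c) ⟩
  bound j + m * c + c        <⟨ +-mono-≤-< (linear≤bound c j m c≤Δ) c<Δ ⟩
  bound (m + j) + Δ (m + j)  ≡⟨ sym (bound-suc (m + j)) ⟩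
  bound (suc m + j)          ∎
  where
  open ≤-Reasoning
  regroup : ∀ x y z → x + (y + z) ≡ x + z + y
  regroup = solve-∀
... | inj₂ Δ≤c = begin-strict
  bound j + suc m * c        ≤⟨ +-monoˡ-≤ (suc m * c) (bound≤linear c j Δ≤c) ⟩
  j * c + suc m * c          ≡⟨ +-comm (j * c) _ ⟩
  suc m * c + j * c          ≡⟨ sym (*-distribʳ-+ c (suc m) j) ⟩
  (suc m + j) * c            <⟨ linear< ⟩
  bound (suc m + j)          ∎
  where open ≤-Reasoning

bound-0-cubic : ∀ k → bound (3 * k) + k * k ≡ 2 * (k * k * k)
bound-0-cubic k = begin
  bound (3 * k) + k * k             ≡⟨ cong (_+ k * k) (bound-0 k) ⟩
  k * ((2 * k) C 2) + k * k         ≡⟨ sym (*-distribˡ-+ k ((2 * k) C 2) k) ⟩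
  k * ((2 * k) C 2 + k)             ≡⟨ cong (k *_) (C2-even k) ⟩
  k * (2 * (k * k))                 ≡⟨ regroup k ⟩
  2 * (k * k * k)                   ∎
  where
  open ≡-Reasoning
  regroup : ∀ k → k * (2 * (k * k)) ≡ 2 * (k * k * k)
  regroup = solve-∀

bound-2-cubic : ∀ k → bound (2 + 3 * k) ≡ k * (suc k * suc (2 * k))
bound-2-cubic k = trans (bound-2 k) (cong (k *_) (C2-even′ k))

bound-1-cubic : ∀ k → bound (1 + 3 * k) ≡ k * k * suc (2 * k)
bound-1-cubic k = +-cancelʳ-≡ (k * suc (2 * k)) _ _ (begin
  bound (1 + 3 * k) + k * suc (2 * k)             ≡⟨ cong (_+ k * suc (2 * k)) (bound-1 k) ⟩
  k * (suc (2 * k) C 2) + k * suc (2 * k)         ≡⟨ +-comm (k * (suc (2 * k) C 2)) _ ⟩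
  k * suc (2 * k) + k * (suc (2 * k) C 2)         ≡⟨ sym (h*C2-suc k (suc (2 * k))) ⟩
  k * (suc (suc (2 * k)) C 2)                     ≡⟨ cong (k *_) (C2-even′ k) ⟩
  k * (suc k * suc (2 * k))                       ≡⟨ expand k ⟩
  k * k * suc (2 * k) + k * suc (2 * k)           ∎)
  where
  open ≡-Reasoning
  expand : ∀ k → k * (suc k * suc (2 * k)) ≡ k * k * suc (2 * k) + k * suc (2 * k)
  expand = solve-∀

-- Numerical thresholds

excess : ∀ {x y} d → y ≡ suc d + x → x < y
excess d refl = s≤s (m≤n+m _ d)

-- Writing k as `suc q + j` leaves polynomials in a free j. The factor 3 lets the lower bound on n
-- be passed on directly.
above-threshold : (P : ℕ → Set) (q : ℕ) → (∀ j → P (suc q + j)) → ∀ k → 3 * q < 3 * k → P k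
above-threshold P q p k 3q<3k with m≤n⇒∃[o]m+o≡n (*-cancelˡ-< 3 q k 3q<3k)
... | j , eq = subst P eq (p j)

-- With k = k₀ + j, the difference of the two sides is a polynomial in j with positive coefficients.
2n²<bound : ∀ n → 29 ≤ n → n * (2 * n) < bound n
2n²<bound n 29≤n = by-residue (mod3 n) 29≤n
  where
  expand-0 : ∀ j → 2 * ((10 + j) * (10 + j) * (10 + j)) ≡
    suc (99 + 220 * j + 41 * (j * j) + 2 * (j * j * j)) + (3 * (10 + j) * (2 * (3 * (10 + j))) + (10 + j) * (10 + j))
  expand-0 = solve-∀
  case-0 : ∀ j → 3 * (10 + j) * (2 * (3 * (10 + j))) < bound (3 * (10 + j))
  case-0 j = +-cancelʳ-< ((10 + j) * (10 + j)) (3 * (10 + j) * (2 * (3 * (10 + j)))) (bound (3 * (10 + j)))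
    (subst (3 * (10 + j) * (2 * (3 * (10 + j))) + (10 + j) * (10 + j) <_) (sym (bound-0-cubic (10 + j)))
      (excess (99 + 220 * j + 41 * (j * j) + 2 * (j * j * j)) (expand-0 j)))
  expand-1 : ∀ j → (10 + j) * (10 + j) * suc (2 * (10 + j)) ≡
    suc (177 + 248 * j + 43 * (j * j) + 2 * (j * j * j)) + (1 + 3 * (10 + j)) * (2 * (1 + 3 * (10 + j)))
  expand-1 = solve-∀
  case-1 : ∀ j → (1 + 3 * (10 + j)) * (2 * (1 + 3 * (10 + j))) < bound (1 + 3 * (10 + j))
  case-1 j = subst ((1 + 3 * (10 + j)) * (2 * (1 + 3 * (10 + j))) <_) (sym (bound-1-cubic (10 + j)))
    (excess (177 + 248 * j + 43 * (j * j) + 2 * (j * j * j)) (expand-1 j))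
  expand-2 : ∀ j → (9 + j) * (suc (9 + j) * suc (2 * (9 + j))) ≡
    suc (27 + 193 * j + 39 * (j * j) + 2 * (j * j * j)) + (2 + 3 * (9 + j)) * (2 * (2 + 3 * (9 + j)))
  expand-2 = solve-∀
  case-2 : ∀ j → (2 + 3 * (9 + j)) * (2 * (2 + 3 * (9 + j))) < bound (2 + 3 * (9 + j))
  case-2 j = subst ((2 + 3 * (9 + j)) * (2 * (2 + 3 * (9 + j))) <_) (sym (bound-2-cubic (9 + j)))
    (excess (27 + 193 * j + 39 * (j * j) + 2 * (j * j * j)) (expand-2 j))
  by-residue : ∀ {n} (v : Mod3 n) → 29 ≤ n → n * (2 * n) < bound n
  by-residue (0mod3 k) 29≤n = above-threshold (λ k → 3 * k * (2 * (3 * k)) < bound (3 * k)) 9 case-0 k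
      (≤-trans (m≤n+m 28 1) 29≤n)
  by-residue (1mod3 k) 29≤n = above-threshold (λ k → (1 + 3 * k) * (2 * (1 + 3 * k)) < bound (1 + 3 * k)) 9 case-1 k
      (≤-pred 29≤n)
  by-residue (2mod3 k) 29≤n = above-threshold (λ k → (2 + 3 * k) * (2 * (2 + 3 * k)) < bound (2 + 3 * k)) 8 case-2 k
      (≤-trans (m≤n+m 25 2) (≤-pred (≤-pred 29≤n)))

-- At n = 69 the two sides agree, so the strict inequality cannot start before 70. The first n ≥ 70
-- in the residue classes 0, 1, 2 are 72, 70, 71, hence the starts 24, 23, 23 for k.
5n²<bound : ∀ n → 70 ≤ n → n * (5 * n) < bound n
5n²<bound n 70≤n = by-residue (mod3 n) 70≤n
  where
  expand-0 : ∀ j → 2 * ((24 + j) * (24 + j) * (24 + j)) ≡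
    suc (1151 + 1248 * j + 98 * (j * j) + 2 * (j * j * j)) + (3 * (24 + j) * (5 * (3 * (24 + j))) + (24 + j) * (24 + j))
  expand-0 = solve-∀
  case-0 : ∀ j → 3 * (24 + j) * (5 * (3 * (24 + j))) < bound (3 * (24 + j))
  case-0 j = +-cancelʳ-< ((24 + j) * (24 + j)) (3 * (24 + j) * (5 * (3 * (24 + j)))) (bound (3 * (24 + j)))
    (subst (3 * (24 + j) * (5 * (3 * (24 + j))) + (24 + j) * (24 + j) <_) (sym (bound-0-cubic (24 + j)))
      (excess (1151 + 1248 * j + 98 * (j * j) + 2 * (j * j * j)) (expand-0 j)))
  expand-1 : ∀ j → (23 + j) * (23 + j) * suc (2 * (23 + j)) ≡
    suc (362 + 1120 * j + 94 * (j * j) + 2 * (j * j * j)) + (1 + 3 * (23 + j)) * (5 * (1 + 3 * (23 + j)))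
  expand-1 = solve-∀
  case-1 : ∀ j → (1 + 3 * (23 + j)) * (5 * (1 + 3 * (23 + j))) < bound (1 + 3 * (23 + j))
  case-1 j = subst ((1 + 3 * (23 + j)) * (5 * (1 + 3 * (23 + j))) <_) (sym (bound-1-cubic (23 + j)))
    (excess (362 + 1120 * j + 94 * (j * j) + 2 * (j * j * j)) (expand-1 j))
  expand-2 : ∀ j → (23 + j) * (suc (23 + j) * suc (2 * (23 + j))) ≡
    suc (738 + 1183 * j + 96 * (j * j) + 2 * (j * j * j)) + (2 + 3 * (23 + j)) * (5 * (2 + 3 * (23 + j)))
  expand-2 = solve-∀
  case-2 : ∀ j → (2 + 3 * (23 + j)) * (5 * (2 + 3 * (23 + j))) < bound (2 + 3 * (23 + j))
  case-2 j = subst ((2 + 3 * (23 + j)) * (5 * (2 + 3 * (23 + j))) <_) (sym (bound-2-cubic (23 + j)))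
    (excess (738 + 1183 * j + 96 * (j * j) + 2 * (j * j * j)) (expand-2 j))
  by-residue : ∀ {n} (v : Mod3 n) → 70 ≤ n → n * (5 * n) < bound n
  by-residue (0mod3 k) 70≤n = above-threshold (λ k → 3 * k * (5 * (3 * k)) < bound (3 * k)) 23 case-0 k
    70≤n
  by-residue (1mod3 k) 70≤n = above-threshold (λ k → (1 + 3 * k) * (5 * (1 + 3 * k)) < bound (1 + 3 * k)) 22 case-1 k
      (≤-trans (m≤n+m 67 2) (≤-pred 70≤n))
  by-residue (2mod3 k) 70≤n = above-threshold (λ k → (2 + 3 * k) * (5 * (2 + 3 * k)) < bound (2 + 3 * k)) 22 case-2 k
      (≤-trans (m≤n+m 67 1) (≤-pred (≤-pred 70≤n)))

-- `Δ` grows quadratically and passes 5n well before `bound` passes 5n². One inequality therefore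
-- serves c = 2n and c = 5n.
5n<Δ : ∀ n → 28 ≤ n → 5 * suc n < Δ n
5n<Δ n 28≤n = by-residue (mod3 n) 28≤n
  where
  expand-0 : ∀ j → (9 + j) * (2 * (9 + j)) ≡
    suc (21 + 21 * j + 2 * (j * j)) + 5 * suc (3 * (9 + j))
  expand-0 = solve-∀
  case-0 : ∀ j → 5 * suc (3 * (9 + j)) < (9 + j) * (2 * (9 + j))
  case-0 j = excess (21 + 21 * j + 2 * (j * j)) (expand-0 j)
  expand-1 : ∀ j → (9 + j) * suc (2 * (9 + j)) ≡
    suc (25 + 22 * j + 2 * (j * j)) + 5 * suc (1 + 3 * (9 + j))
  expand-1 = solve-∀
  case-1 : ∀ j → 5 * suc (1 + 3 * (9 + j)) < (9 + j) * suc (2 * (9 + j))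
  case-1 j = excess (25 + 22 * j + 2 * (j * j)) (expand-1 j)
  expand-2 : ∀ j → suc (9 + j) * suc (2 * (9 + j)) ≡
    suc (39 + 24 * j + 2 * (j * j)) + 5 * suc (2 + 3 * (9 + j))
  expand-2 = solve-∀
  case-2 : ∀ j → 5 * suc (2 + 3 * (9 + j)) < suc (9 + j) * suc (2 * (9 + j))
  case-2 j = excess (39 + 24 * j + 2 * (j * j)) (expand-2 j)
  by-residue : ∀ {n} (v : Mod3 n) → 28 ≤ n → 5 * suc n < Δ′ v
  by-residue (0mod3 k) 28≤n = above-threshold (λ k → 5 * suc (3 * k) < k * (2 * k)) 8 case-0 k
      (≤-trans (m≤n+m 25 3) 28≤n)
  by-residue (1mod3 k) 28≤n = above-threshold (λ k → 5 * suc (1 + 3 * k) < k * suc (2 * k)) 8 case-1 k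
      (≤-trans (m≤n+m 25 2) (≤-pred 28≤n))
  by-residue (2mod3 k) 28≤n = above-threshold (λ k → 5 * suc (2 + 3 * k) < suc k * suc (2 * k)) 8 case-2 k
      (≤-trans (m≤n+m 25 1) (≤-pred (≤-pred 28≤n)))

5n<Δ-pred : ∀ n → 29 ≤ n → 5 * n < Δ (pred n)
5n<Δ-pred (suc n) 29≤n = 5n<Δ n (≤-pred 29≤n)

-- Optimal class sizes for each residue

m≤n⇒∃[o]o+m≡n : ∀ {m n} → m ≤ n → ∃ λ o → o + m ≡ n
m≤n⇒∃[o]o+m≡n {m} {n} m≤n = n ∸ m , m∸n+n≡m m≤n

-- The window for t′ is wider by one on either side than in `optimum-unique`, because a step at the
-- turning point changes nothing. It thus admits the tied sizes (k, 2k + 2).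
optimum-≤ : ∀ h t h′ t′ → h + t ≡ h′ + t′ → 2 * h′ ≤ suc t′ → t′ ≤ suc (suc (2 * h′)) →
            h * (t C 2) ≤ h′ * (t′ C 2)
optimum-≤ h t h′ t′ eq p q with ≤-total h h′
... | inj₁ h≤h′ with m≤n⇒∃[o]o+m≡n h≤h′
...   | d , refl = subst (λ s → h * (s C 2) ≤ (d + h) * (t′ C 2))
        (+-cancelˡ-≡ h _ _ (trans (regroup h d t′) (sym eq))) (climb-up d h t′ p)
  where
  regroup : ∀ h d t → h + (d + t) ≡ d + h + t
  regroup = solve-∀
optimum-≤ h t h′ t′ eq p q | inj₂ h′≤h with m≤n⇒∃[o]o+m≡n h′≤h
...   | d , refl = subst (λ s → (d + h′) * (t C 2) ≤ h′ * (s C 2)) s≡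
        (climb-down d h′ t (subst (_≤ suc (suc (2 * h′))) (sym s≡) q))
  where
  regroup : ∀ h d t → h + (d + t) ≡ d + h + t
  regroup = solve-∀
  s≡ : d + t ≡ t′
  s≡ = +-cancelˡ-≡ h′ _ _ (trans (regroup h′ d t) eq)

h*C2≤bound : ∀ h t → h * (t C 2) ≤ bound (h + t)
h*C2≤bound h t = by-residue (mod3 (h + t)) refl
  where
  by-residue : ∀ {n} → Mod3 n → h + t ≡ n → h * (t C 2) ≤ bound n
  by-residue (0mod3 k) eq = ≤-trans
    (optimum-≤ h t k (2 * k) eq (n≤1+n _) (m≤n+m _ 2))
    (≤-reflexive (sym (bound-0 k)))
  by-residue (1mod3 k) eq = ≤-trans
    (optimum-≤ h t k (suc (2 * k)) (trans eq (sym (+-suc k (2 * k)))) (m≤n+m _ 2) (n≤1+n _))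
    (≤-reflexive (sym (bound-1 k)))
  by-residue (2mod3 k) eq = ≤-trans
    (optimum-≤ h t k (2 + 2 * k)
      (trans eq (sym (trans (+-suc k _) (cong suc (+-suc k (2 * k)))))) (m≤n+m _ 3) ≤-refl)
    (≤-reflexive (sym (bound-2 k)))

optimum-unique : ∀ h t h′ t′ → h + t ≡ h′ + t′ → 2 * h′ ≤ t′ → t′ ≤ suc (2 * h′) → 2 ≤ t′ →
                 h * (t C 2) ≡ h′ * (t′ C 2) → h ≡ h′
optimum-unique h t h′ t′ eq p q 2≤t′ max with <-cmp h h′
... | tri< h<h′ _ _ = contradiction max (<⇒≢ (optimum-below h t h′ t′ eq h<h′ p))
... | tri≈ _ h≡h′ _ = h≡h′
... | tri> _ _ h′<h = contradiction max (<⇒≢ (optimum-above h t h′ t′ eq h′<h q 2≤t′))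

-- At t = 2k + 1 the numbers C(t,2) and k·t coincide, so the step is neutral. This is the source of
-- the second extremal graph for n ≡ 2.
tie : ∀ k → suc k * (suc (2 * k) C 2) ≡ k * ((2 + 2 * k) C 2)
tie k = ≤-antisym (step-down k (suc (2 * k)) ≤-refl) (step-up k (suc (2 * k)) ≤-refl)

-- Strictness is measured against the nearer of the two tied optima: from below against k, from
-- above against k + 1.
optimum-two : ∀ h t k → 0 < k → h + t ≡ 2 + 3 * k → h * (t C 2) ≡ k * ((2 + 2 * k) C 2) →
              h ≡ k ⊎ h ≡ suc k
optimum-two h t k 0<k eq max with <-cmp h k
... | tri< h<k _ _ = contradiction max (<⇒≢
      (optimum-below h t k (2 + 2 * k) (trans eq (regroup k)) h<k (m≤n+m _ 2)))
  where
  regroup : ∀ k → 2 + 3 * k ≡ k + (2 + 2 * k)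
  regroup = solve-∀
... | tri≈ _ h≡k _ = inj₁ h≡k
... | tri> _ _ k<h with m≤n⇒m<n∨m≡n k<h
...   | inj₂ refl = inj₂ refl
...   | inj₁ 1+k<h = contradiction (trans max (sym (tie k))) (<⇒≢
        (optimum-above h t (suc k) (suc (2 * k)) (trans eq (regroup k)) 1+k<h
          (s≤s (*-monoʳ-≤ 2 (n≤1+n k))) (s≤s (≤-trans 0<k (m≤m+n k _)))))
  where
  regroup : ∀ k → 2 + 3 * k ≡ suc k + suc (2 * k)
  regroup = solve-∀

-- Finite sums and counting

⟦_⟧ : Bool → ℕ
⟦ b ⟧ = if b then 1 else 0

⟦∧⟧ : ∀ x y → ⟦ x ∧ y ⟧ ≡ ⟦ x ⟧ * ⟦ y ⟧
⟦∧⟧ true y = sym (+-identityʳ ⟦ y ⟧)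
⟦∧⟧ false y = refl

⟦⟧≤1 : ∀ b → ⟦ b ⟧ ≤ 1
⟦⟧≤1 true = ≤-refl
⟦⟧≤1 false = z≤n

⟦⟧-injective : ∀ {x y} → ⟦ x ⟧ ≡ ⟦ y ⟧ → x ≡ y
⟦⟧-injective {true} {true} _ = refl
⟦⟧-injective {false} {false} _ = refl

sum-allFin : ∀ {n} (f : Fin n → ℕ) → List.sum (map f (allFin n)) ≡ sum f
sum-allFin f = trans (cong List.sum (map-tabulate id f)) (sum-tabulate f)
  where
  sum-tabulate : ∀ {n} (f : Fin n → ℕ) → List.sum (tabulate f) ≡ sum f
  sum-tabulate {zero} f = refl
  sum-tabulate {suc n} f = cong (f zero +_) (sum-tabulate (f ∘ suc))

sum-mono : ∀ {n} {f g : Fin n → ℕ} → (∀ i → f i ≤ g i) → sum f ≤ sum g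
sum-mono {zero} p = z≤n
sum-mono {suc n} p = +-mono-≤ (p zero) (sum-mono (p ∘ suc))

-- A strict inequality in one term could not be made up by the others. This is how equal edge
-- numbers become equal graphs.
sum-tight : ∀ {n} {f g : Fin n → ℕ} → (∀ i → f i ≤ g i) → sum g ≤ sum f → ∀ i → f i ≡ g i
sum-tight {suc n} {f} {g} p q zero = ≤-antisym (p zero)
  (+-cancelʳ-≤ (sum (g ∘ suc)) _ _ (≤-trans q (+-monoʳ-≤ (f zero) (sum-mono (p ∘ suc)))))
sum-tight {suc n} {f} {g} p q (suc i) = sum-tight (p ∘ suc)
  (+-cancelˡ-≤ (g zero) _ _ (≤-trans q (+-monoˡ-≤ _ (p zero)))) i

sum-const : ∀ n c → ∑[ i < n ] c ≡ n * c
sum-const zero c = refl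
sum-const (suc n) c = cong (c +_) (sum-const n c)

sum-*ʳ : ∀ {n} (f : Fin n → ℕ) c → ∑[ i < n ] (f i * c) ≡ sum f * c
sum-*ʳ f c = sym (*-distribʳ-sum c f)

sum-*ˡ : ∀ {n} c (f : Fin n → ℕ) → ∑[ i < n ] (c * f i) ≡ c * sum f
sum-*ˡ c f = sym (*-distribˡ-sum c f)

δ : ∀ {n} → Fin n → Fin n → ℕ
δ i j = ⟦ does (i ≟ᶠ j) ⟧

δ-refl : ∀ {n} (i : Fin n) → δ i i ≡ 1
δ-refl zero = refl
δ-refl (suc i) = δ-refl i

sum-δ : ∀ {n} (i : Fin n) → ∑[ j < n ] δ i j ≡ 1
sum-δ {suc n} zero = cong suc (trans (sum-const n 0) (*-zeroʳ n))
sum-δ {suc n} (suc i) = sum-δ i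

∑₂ : ∀ {n} → (Fin n → Fin n → ℕ) → ℕ
∑₂ {n} f = ∑[ i < n ] ∑[ j < n ] f i j

∑₂-mono : ∀ {n} {f g : Fin n → Fin n → ℕ} → (∀ i j → f i j ≤ g i j) → ∑₂ f ≤ ∑₂ g
∑₂-mono p = sum-mono (λ i → sum-mono (p i))

∑₂-cong : ∀ {n} {f g : Fin n → Fin n → ℕ} → (∀ i j → f i j ≡ g i j) → ∑₂ f ≡ ∑₂ g
∑₂-cong p = sum-cong-≗ (λ i → sum-cong-≗ (p i))

∑₂-+ : ∀ {n} (f g : Fin n → Fin n → ℕ) → ∑₂ (λ i j → f i j + g i j) ≡ ∑₂ f + ∑₂ g
∑₂-+ f g = trans (sum-cong-≗ (λ i → ∑-distrib-+ (f i) (g i)))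
  (∑-distrib-+ (λ i → sum (f i)) (λ i → sum (g i)))

∑₂-row : ∀ {n} (a : Fin n) → ∑₂ (λ i j → δ a i) ≡ n
∑₂-row {n} a = begin
  ∑[ i < n ] ∑[ j < n ] δ a i   ≡⟨ sum-cong-≗ (λ i → sum-const n (δ a i)) ⟩
  ∑[ i < n ] (n * δ a i)        ≡⟨ sum-*ˡ n (δ a) ⟩
  n * sum (δ a)                 ≡⟨ cong (n *_) (sum-δ a) ⟩
  n * 1                         ≡⟨ *-identityʳ n ⟩
  n                             ∎
  where open ≡-Reasoning

∑₂-col : ∀ {n} (a : Fin n) → ∑₂ (λ i j → δ a j) ≡ n
∑₂-col {n} a = trans (∑-comm {n} {n} (λ i j → δ a j)) (∑₂-row a)

∑₂-* : ∀ {n} (f g : Fin n → ℕ) → ∑₂ (λ i j → f i * g j) ≡ sum f * sum g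
∑₂-* f g = trans (sum-cong-≗ (λ i → sum-*ˡ (f i) g)) (sum-*ʳ f (sum g))

∑₂-cell : ∀ {n} (a b : Fin n) → ∑₂ (λ i j → δ a i * δ b j) ≡ 1
∑₂-cell a b = trans (∑₂-* (δ a) (δ b)) (cong₂ _*_ (sum-δ a) (sum-δ b))

∑₃ : ∀ {n} → (Fin n → Fin n → Fin n → ℕ) → ℕ
∑₃ {n} f = ∑[ i < n ] ∑₂ (f i)

∑₃-mono : ∀ {n} {f g : Fin n → Fin n → Fin n → ℕ} → (∀ i j k → f i j k ≤ g i j k) → ∑₃ f ≤ ∑₃ g
∑₃-mono p = sum-mono (λ i → ∑₂-mono (p i))

∑₃-cong : ∀ {n} {f g : Fin n → Fin n → Fin n → ℕ} → (∀ i j k → f i j k ≡ g i j k) → ∑₃ f ≡ ∑₃ g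
∑₃-cong p = sum-cong-≗ (λ i → ∑₂-cong (p i))

∑₃-+ : ∀ {n} (f g : Fin n → Fin n → Fin n → ℕ) → ∑₃ (λ i j k → f i j k + g i j k) ≡ ∑₃ f + ∑₃ g
∑₃-+ f g = trans (sum-cong-≗ (λ i → ∑₂-+ (f i) (g i)))
  (∑-distrib-+ (λ i → ∑₂ (f i)) (λ i → ∑₂ (g i)))

∑₃-tight : ∀ {n} {f g : Fin n → Fin n → Fin n → ℕ} → (∀ i j k → f i j k ≤ g i j k) →
           ∑₃ g ≤ ∑₃ f → ∀ i j k → f i j k ≡ g i j k
∑₃-tight p q i j = sum-tight (p i j)
  (≤-reflexive (sym (sum-tight (λ j → sum-mono (p i j))
    (≤-reflexive (sym (sum-tight (λ i → ∑₂-mono (p i)) q i))) j)))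

count : ∀ {n} → (Fin n → Bool) → ℕ
count f = sum (λ i → ⟦ f i ⟧)

count-pos : ∀ {n} (f : Fin n → Bool) → 0 < count f → ∃ λ i → f i ≡ true
count-pos {suc n} f p with f zero in eq
... | true = zero , eq
... | false with count-pos (f ∘ suc) p
...   | i , fi = suc i , fi

count-small : ∀ {n} (f : Fin n → Bool) → count f < n → ∃ λ i → f i ≡ false
count-small {suc n} f p with f zero in eq
... | false = zero , eq
... | true with count-small (f ∘ suc) (≤-pred p)
...   | i , fi = suc i , fi

count≤ : ∀ {n} (f : Fin n → Bool) → count f ≤ n
count≤ {n} f = ≤-trans (sum-mono (λ i → ⟦⟧≤1 (f i))) (≤-reflexive (trans (sum-const n 1) (*-identityʳ n)))

-- Induction on n: vertex 0 is matched with some j of the same label, both are deleted, and `insert`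
-- extends the permutation of the rest.
equal-counts⇒permutation : ∀ {n} (f g : Fin n → Bool) → count f ≡ count g →
  Σ (Permutation n n) λ π → ∀ i → f i ≡ g (π ⟨$⟩ʳ i)
equal-counts⇒permutation {zero} f g eq = idₚ , λ ()
equal-counts⇒permutation {suc n} f g eq = extend (partner (f zero) refl)
  where
  partner : ∀ b → f zero ≡ b → ∃ λ j → g j ≡ b
  partner true f₀ = count-pos g (subst (0 <_) eq
    (subst (λ b → 0 < ⟦ b ⟧ + count (f ∘ suc)) (sym f₀) (s≤s z≤n)))
  partner false f₀ = count-small g (subst (_< suc n) eq
    (subst (λ b → ⟦ b ⟧ + count (f ∘ suc) < suc n) (sym f₀) (s≤s (count≤ (f ∘ suc)))))
  extend : (∃ λ j → g j ≡ f zero) → Σ (Permutation (suc n) (suc n)) λ π → ∀ i → f i ≡ g (π ⟨$⟩ʳ i)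
  extend (j , gj) = insert zero j (proj₁ rest) , agrees
    where
    rest = equal-counts⇒permutation (f ∘ suc) (g ∘ punchIn j) (+-cancelˡ-≡ ⟦ f zero ⟧ _ _
      (trans eq (trans (sum-remove {i = j} (λ i → ⟦ g i ⟧))
        (cong (λ b → ⟦ b ⟧ + count (g ∘ punchIn j)) gj))))
    agrees : ∀ i → f i ≡ g (insert zero j (proj₁ rest) ⟨$⟩ʳ i)
    agrees zero = sym gj
    agrees (suc i) = trans (proj₂ rest i) (cong g (sym (insert-punchIn zero j (proj₁ rest) i)))

count-below : ∀ {n} t → t ≤ n → count {n} (λ i → toℕ i <ᵇ t) ≡ t
count-below {n} zero _ = trans (sum-const n 0) (*-zeroʳ n)
count-below {suc n} (suc t) (s≤s t≤n) = cong suc (count-below t t≤n)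

count-not : ∀ {n} (f : Fin n → Bool) → count f + count (not ∘ f) ≡ n
count-not {n} f = trans (sym (∑-distrib-+ (λ i → ⟦ f i ⟧) (λ i → ⟦ not (f i) ⟧)))
  (trans (sum-cong-≗ (λ i → one (f i))) (trans (sum-const n 1) (*-identityʳ n)))
  where
  one : ∀ b → ⟦ b ⟧ + ⟦ not b ⟧ ≡ 1
  one true = refl
  one false = refl

-- `τ` and `η` are separate arguments because mixed vertices belong neither to the non-heads nor to
-- the pure heads.
K : ∀ {n} → (Fin n → Bool) → (Fin n → Bool) → Raw n
K τ η a b c = (τ a ∧ (τ b ∧ not (does (a ≟ᶠ b)))) ∧ η c

-- Adding the diagonal completes the ordered pairs to a full square, and t² = 2·C(t,2) + t.
∑₂-offdiagonal : ∀ {n} (τ : Fin n → Bool) →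
  ∑₂ (λ a b → ⟦ τ a ∧ (τ b ∧ not (does (a ≟ᶠ b))) ⟧) ≡ 2 * (count τ C 2)
∑₂-offdiagonal {n} τ = +-cancelʳ-≡ (count τ) _ _ (begin
  ∑₂ off + count τ                       ≡⟨ cong (∑₂ off +_) (sym (sum-cong-≗ diagonal)) ⟩
  ∑₂ off + ∑₂ (λ a b → δ a b * ⟦ τ a ⟧)  ≡⟨ sym (∑₂-+ off (λ a b → δ a b * ⟦ τ a ⟧)) ⟩
  ∑₂ (λ a b → off a b + δ a b * ⟦ τ a ⟧) ≡⟨ ∑₂-cong split ⟩
  ∑₂ (λ a b → ⟦ τ a ⟧ * ⟦ τ b ⟧)         ≡⟨ ∑₂-* (λ a → ⟦ τ a ⟧) (λ b → ⟦ τ b ⟧) ⟩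
  count τ * count τ                      ≡⟨ sym (C2-double (count τ)) ⟩
  2 * (count τ C 2) + count τ            ∎)
  where
  open ≡-Reasoning
  off : Fin n → Fin n → ℕ
  off a b = ⟦ τ a ∧ (τ b ∧ not (does (a ≟ᶠ b))) ⟧
  diagonal : ∀ a → ∑[ b < n ] (δ a b * ⟦ τ a ⟧) ≡ ⟦ τ a ⟧
  diagonal a = trans (sum-*ʳ (δ a) ⟦ τ a ⟧) (trans (cong (_* ⟦ τ a ⟧) (sum-δ a)) (*-identityˡ ⟦ τ a ⟧))
  off-true : ∀ x y → ⟦ x ∧ (y ∧ true) ⟧ + 0 ≡ ⟦ x ⟧ * ⟦ y ⟧
  off-true true true = refl
  off-true true false = refl
  off-true false _ = refl
  on : ∀ x → ⟦ x ∧ (x ∧ false) ⟧ + 1 * ⟦ x ⟧ ≡ ⟦ x ⟧ * ⟦ x ⟧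
  on true = refl
  on false = refl
  split : ∀ a b → off a b + δ a b * ⟦ τ a ⟧ ≡ ⟦ τ a ⟧ * ⟦ τ b ⟧
  split a b with a ≟ᶠ b
  ... | yes refl = on (τ a)
  ... | no _ = off-true (τ a) (τ b)

∑₃-K : ∀ {n} (τ η : Fin n → Bool) →
       ∑₃ (λ a b c → ⟦ K τ η a b c ⟧) ≡ 2 * (count η * (count τ C 2))
∑₃-K {n} τ η = begin
  ∑₃ (λ a b c → ⟦ K τ η a b c ⟧)        ≡⟨ ∑₃-cong (λ a b c → ⟦∧⟧ (off a b) (η c)) ⟩
  ∑₃ (λ a b c → ⟦ off a b ⟧ * ⟦ η c ⟧)  ≡⟨ ∑₂-cong (λ a b → sum-*ˡ ⟦ off a b ⟧ (λ c → ⟦ η c ⟧)) ⟩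
  ∑₂ (λ a b → ⟦ off a b ⟧ * count η)    ≡⟨ sum-cong-≗ (λ a → sum-*ʳ (λ b → ⟦ off a b ⟧) (count η)) ⟩
  ∑[ a < n ] (sum (λ b → ⟦ off a b ⟧) * count η)  ≡⟨ sum-*ʳ (λ a → sum (λ b → ⟦ off a b ⟧)) (count η) ⟩
  ∑₂ (λ a b → ⟦ off a b ⟧) * count η    ≡⟨ cong (_* count η) (∑₂-offdiagonal τ) ⟩
  2 * (count τ C 2) * count η           ≡⟨ regroup (count τ C 2) (count η) ⟩
  2 * (count η * (count τ C 2))         ∎
  where
  open ≡-Reasoning
  off : Fin n → Fin n → Bool
  off a b = τ a ∧ (τ b ∧ not (does (a ≟ᶠ b)))
  regroup : ∀ x y → 2 * x * y ≡ 2 * (y * x)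
  regroup = solve-∀

-- Tails are symmetric and never degenerate, so exactly one of the two orders of each tail is
-- increasing. The ordered sum is free of `toℕ` and carries all later counting.
edgeCount-double : ∀ {n} (E : Raw n) → IsGraph E → ∑₃ (λ a b c → ⟦ E a b c ⟧) ≡ 2 * edgeCount E
edgeCount-double {n} E G = begin
  ∑₃ (λ a b c → ⟦ E a b c ⟧)                       ≡⟨ ∑₃-cong split ⟩
  ∑₃ (λ a b c → half a b c + half b a c)           ≡⟨ ∑₃-+ half (λ a b c → half b a c) ⟩
  ∑₃ half + ∑₃ (λ a b c → half b a c)              ≡⟨ cong (∑₃ half +_) (∑-comm (λ a b → sum (half b a))) ⟩
  ∑₃ half + ∑₃ half                                ≡⟨ cong (∑₃ half +_) (sym (+-identityʳ _)) ⟩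
  2 * ∑₃ half                                      ≡⟨ cong (2 *_) (sym edgeCount≡) ⟩
  2 * edgeCount E                                  ∎
  where
  open ≡-Reasoning
  half : Fin n → Fin n → Fin n → ℕ
  half a b c = ⟦ (toℕ a <ᵇ toℕ b) ∧ E a b c ⟧
  edgeCount≡ : edgeCount E ≡ ∑₃ half
  edgeCount≡ = trans
    (sum-allFin (λ a → List.sum (map (λ b → List.sum (map (half a b) (allFin n))) (allFin n))))
    (sum-cong-≗ (λ a → trans
      (sum-allFin (λ b → List.sum (map (half a b) (allFin n))))
      (sum-cong-≗ (λ b → sum-allFin (half a b)))))
  order : ∀ {m} (a b : Fin m) → a ≡ b ⊎ ((toℕ a <ᵇ toℕ b) ≡ true × (toℕ b <ᵇ toℕ a) ≡ false)
                                      ⊎ ((toℕ a <ᵇ toℕ b) ≡ false × (toℕ b <ᵇ toℕ a) ≡ true)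
  order zero zero = inj₁ refl
  order zero (suc b) = inj₂ (inj₁ (refl , refl))
  order (suc a) zero = inj₂ (inj₂ (refl , refl))
  order (suc a) (suc b) with order a b
  ... | inj₁ refl = inj₁ refl
  ... | inj₂ o = inj₂ o
  loop : ∀ a c → E a a c ≡ false
  loop a c with E a a c in eq
  ... | false = refl
  ... | true = contradiction refl (proj₁ (IsGraph.distinct G a a c eq))
  ∧-false : ∀ x → x ∧ false ≡ false
  ∧-false true = refl
  ∧-false false = refl
  split : ∀ a b c → ⟦ E a b c ⟧ ≡ half a b c + half b a c
  split a b c with order a b
  ... | inj₁ refl rewrite loop a c | ∧-false (toℕ a <ᵇ toℕ a) = refl
  ... | inj₂ (inj₁ (p , q)) rewrite p | q = sym (+-identityʳ _)
  ... | inj₂ (inj₂ (p , q)) rewrite p | q = cong ⟦_⟧ (IsGraph.tailSym G a b c)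

-- Links of a vertex that is both a head and a tail

R4-edges : ∀ a b c → R4 a b c ≡ true →
  ((a ≡ 0F × b ≡ 1F × c ≡ 2F) ⊎ (a ≡ 1F × b ≡ 0F × c ≡ 2F)) ⊎
  ((a ≡ 2F × b ≡ 3F × c ≡ 4F) ⊎ (a ≡ 3F × b ≡ 2F × c ≡ 4F))
R4-edges = from-yes (all? λ a → all? λ b → all? λ c → (R4 a b c ≟ᵇ true) →-dec
  (((a ≟ᶠ 0F ×-dec b ≟ᶠ 1F ×-dec c ≟ᶠ 2F) ⊎-dec (a ≟ᶠ 1F ×-dec b ≟ᶠ 0F ×-dec c ≟ᶠ 2F)) ⊎-dec
   ((a ≟ᶠ 2F ×-dec b ≟ᶠ 3F ×-dec c ≟ᶠ 4F) ⊎-dec (a ≟ᶠ 3F ×-dec b ≟ᶠ 2F ×-dec c ≟ᶠ 4F))))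

_∈₂_ : ∀ {n} → Fin n → Fin n × Fin n → Set
d ∈₂ (a , b) = d ≡ a ⊎ d ≡ b

Meets : ∀ {n} → Fin n → Fin n → Fin n → Fin n → Set
Meets a b d e = (d ∈₂ (a , b)) ⊎ (e ∈₂ (a , b))

meets? : ∀ {n} (a b d e : Fin n) → Dec (Meets a b d e)
meets? a b d e = (d ≟ᶠ a ⊎-dec d ≟ᶠ b) ⊎-dec (e ≟ᶠ a ⊎-dec e ≟ᶠ b)

meets-sym : ∀ {n} {a b d e : Fin n} → Meets a b d e → Meets d e a b
meets-sym (inj₁ (inj₁ p)) = inj₁ (inj₁ (sym p))
meets-sym (inj₁ (inj₂ p)) = inj₂ (inj₁ (sym p))
meets-sym (inj₂ (inj₁ p)) = inj₁ (inj₂ (sym p))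
meets-sym (inj₂ (inj₂ p)) = inj₂ (inj₂ (sym p))

-- The two edges already keep x apart from the other vertices, a from b, and d from e. If the pairs
-- were disjoint as well, all five vertices would differ and form a copy of `R4`.
free⇒meets : ∀ {n} {E : Raw n} → IsGraph E → Free R4 E →
  ∀ {a b x d e} → E a b x ≡ true → E x d e ≡ true → Meets a b d e
free⇒meets {n} {E} G free {a} {b} {x} {d} {e} abx xde with meets? a b d e
... | yes m = m
... | no ¬m = ⊥-elim (free (φ , injective , hom))
  where
  open IsGraph G
  φ : Fin 5 → Fin n
  φ = lookup (a ∷ b ∷ x ∷ d ∷ e ∷ [])
  unique : Unique (a ∷ b ∷ x ∷ d ∷ e ∷ [])
  unique with distinct a b x abx | distinct x d e xde
  ... | a≢b , a≢x , b≢x | x≢d , x≢e , d≢e =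
    (a≢b All.∷ a≢x All.∷ (λ p → ¬m (inj₁ (inj₁ (sym p)))) All.∷ (λ p → ¬m (inj₂ (inj₁ (sym p)))) All.∷ All.[]) AllPairs.∷
    (b≢x All.∷ (λ p → ¬m (inj₁ (inj₂ (sym p)))) All.∷ (λ p → ¬m (inj₂ (inj₂ (sym p)))) All.∷ All.[]) AllPairs.∷
    (x≢d All.∷ x≢e All.∷ All.[]) AllPairs.∷ (d≢e All.∷ All.[]) AllPairs.∷ All.[] AllPairs.∷ AllPairs.[]
  injective : Injective _≡_ _≡_ φ
  injective {i} {j} = lookup-injective unique i j
  hom : IsHom R4 E φ
  hom u v w p with R4-edges u v w p
  ... | inj₁ (inj₁ (refl , refl , refl)) = abx
  ... | inj₁ (inj₂ (refl , refl , refl)) = trans (tailSym b a x) abx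
  ... | inj₂ (inj₁ (refl , refl , refl)) = xde
  ... | inj₂ (inj₂ (refl , refl , refl)) = trans (tailSym d x e) xde

δ-≡ : ∀ {n} {i j : Fin n} → j ≡ i → δ i j ≡ 1
δ-≡ {i = i} refl = δ-refl i

δ-≢ : ∀ {n} {i j : Fin n} → i ≢ j → δ i j ≡ 0
δ-≢ {i = i} {j} i≢j with i ≟ᶠ j
... | yes i≡j = contradiction i≡j i≢j
... | no _ = refl

pair : ∀ {n} → Fin n → Fin n → Fin n → ℕ
pair a b d = δ a d + δ b d

-- In the grid of pairs (d, e) these are the two rows and two columns of a and b, with overlaps
-- counted repeatedly: a majorant of `Meets` with total 4n.
cross : ∀ {n} → Fin n → Fin n → Fin n → Fin n → ℕ
cross a b d e = pair a b d + pair a b e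

∈₂⇒1≤pair : ∀ {n} {a b d : Fin n} → d ∈₂ (a , b) → 1 ≤ pair a b d
∈₂⇒1≤pair {a = a} {b} {d} (inj₁ p) = ≤-trans (≤-reflexive (sym (δ-≡ p))) (m≤m+n (δ a d) (δ b d))
∈₂⇒1≤pair {a = a} {b} {d} (inj₂ p) = ≤-trans (≤-reflexive (sym (δ-≡ p))) (m≤n+m (δ b d) (δ a d))

meets⇒1≤cross : ∀ {n} {a b d e : Fin n} → Meets a b d e → 1 ≤ cross a b d e
meets⇒1≤cross (inj₁ p) = ≤-trans (∈₂⇒1≤pair p) (m≤m+n _ _)
meets⇒1≤cross {a = a} {b} {d} (inj₂ p) = ≤-trans (∈₂⇒1≤pair p) (m≤n+m _ (pair a b d))

sum-pair : ∀ {n} (a b : Fin n) → sum (pair a b) ≡ 2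
sum-pair a b = trans (∑-distrib-+ (δ a) (δ b)) (cong₂ _+_ (sum-δ a) (sum-δ b))

∑₂-cross : ∀ {n} (a b : Fin n) → ∑₂ (cross a b) ≡ 4 * n
∑₂-cross {n} a b = begin
  ∑₂ (cross a b)     ≡⟨ ∑₂-+ (λ d e → pair a b d) (λ d e → pair a b e) ⟩
  ∑₂ (λ (d e : Fin n) → pair a b d) + ∑₂ (λ (d e : Fin n) → pair a b e)
    ≡⟨ cong₂ _+_ (∑₂-+ (λ d e → δ a d) (λ d e → δ b d)) (∑₂-+ (λ d e → δ a e) (λ d e → δ b e)) ⟩
  (∑₂ (λ (d e : Fin n) → δ a d) + ∑₂ (λ (d e : Fin n) → δ b d)) +
  (∑₂ (λ (d e : Fin n) → δ a e) + ∑₂ (λ (d e : Fin n) → δ b e))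
    ≡⟨ cong₂ _+_ (cong₂ _+_ (∑₂-row a) (∑₂-row b)) (cong₂ _+_ (∑₂-col a) (∑₂-col b)) ⟩
  (n + n) + (n + n)  ≡⟨ four n ⟩
  4 * n              ∎
  where
  open ≡-Reasoning
  four : ∀ n → (n + n) + (n + n) ≡ 4 * n
  four = solve-∀

⟦⟧≤ : ∀ b {m} → (b ≡ true → 1 ≤ m) → ⟦ b ⟧ ≤ m
⟦⟧≤ true p = p refl
⟦⟧≤ false _ = z≤n

-- headWeight counts both orders of a tail, so weight is twice the number of edges through x.
tailWeight headWeight weight : ∀ {n} → Raw n → Fin n → ℕ
tailWeight E x = ∑₂ (λ d e → ⟦ E x d e ⟧)
headWeight E x = ∑₂ (λ d e → ⟦ E d e x ⟧)
weight E x = tailWeight E x + tailWeight E x + headWeight E x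

IsHead IsTail : ∀ {n} → Raw n → Fin n → Set
IsHead E x = ∃ λ a → ∃ λ b → E a b x ≡ true
IsTail E x = ∃ λ a → ∃ λ b → E x a b ≡ true

-- If all head pairs lie inside {a, b}, the head link has constant size and the tail link at most
-- 4n. If a head pair pq has q outside {a, b}, tail pairs must meet both ab and pq, which cuts the
-- tail link to 2n + 4, while the head link meets yz and has at most 4n. Either way the weight is at
-- most 8n + 8, and n ≥ 4 turns this into 10n.
weight-standard : ∀ {n} {E : Raw n} → IsGraph E → Free R4 E → 4 ≤ n →
                  ∀ x → IsHead E x → IsTail E x → weight E x ≤ 2 * (5 * n)
weight-standard {n} {E} G free 4≤n x (a , b , abx) (y , z , xyz)
  with any? (λ p → any? (λ q → (E p q x ≟ᵇ true) ×-dec ¬? (q ≟ᶠ a ⊎-dec q ≟ᶠ b)))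
... | no none = begin
  T + T + headWeight E x     ≤⟨ +-mono-≤ (+-mono-≤ T≤ T≤) (∑₂-mono (λ d e → ⟦⟧≤ (E d e x) (inside d e))) ⟩
  4 * n + 4 * n + ∑₂ (λ d e → pair a b d * pair a b e)
    ≡⟨ cong (4 * n + 4 * n +_) (trans (∑₂-* (pair a b) (pair a b)) (cong₂ _*_ (sum-pair a b) (sum-pair a b))) ⟩
  4 * n + 4 * n + 4          ≤⟨ +-monoʳ-≤ (4 * n + 4 * n) 4≤n ⟩
  4 * n + 4 * n + n          ≤⟨ m≤m+n _ n ⟩
  4 * n + 4 * n + n + n      ≡⟨ ten n ⟩
  2 * (5 * n)                ∎
  where
  open ≤-Reasoning
  open IsGraph G
  T = tailWeight E x
  T≤ : T ≤ 4 * n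
  T≤ = ≤-trans (∑₂-mono (λ d e → ⟦⟧≤ (E x d e) (λ p → meets⇒1≤cross (free⇒meets G free abx p))))
               (≤-reflexive (∑₂-cross a b))
  end∈ : ∀ d e → E d e x ≡ true → e ∈₂ (a , b)
  end∈ d e p with e ≟ᶠ a ⊎-dec e ≟ᶠ b
  ... | yes e∈ = e∈
  ... | no e∉ = contradiction (d , e , p , e∉) none
  inside : ∀ d e → E d e x ≡ true → 1 ≤ pair a b d * pair a b e
  inside d e p = *-mono-≤ (∈₂⇒1≤pair (end∈ e d (trans (tailSym e d x) p))) (∈₂⇒1≤pair (end∈ d e p))
  ten : ∀ n → 4 * n + 4 * n + n + n ≡ 2 * (5 * n)
  ten = solve-∀
... | yes (p , q , pqx , q∉ab) = begin
  T + T + headWeight E x     ≤⟨ +-mono-≤ (+-mono-≤ T≤ T≤) D≤ ⟩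
  (n + n + 4) + (n + n + 4) + 4 * n   ≤⟨ +-monoˡ-≤ (4 * n) (+-mono-≤ (+-monoʳ-≤ (n + n) 4≤n) (+-monoʳ-≤ (n + n) 4≤n)) ⟩
  (n + n + n) + (n + n + n) + 4 * n   ≡⟨ ten n ⟩
  2 * (5 * n)                ∎
  where
  open ≤-Reasoning
  T = tailWeight E x
  D≤ : headWeight E x ≤ 4 * n
  D≤ = ≤-trans (∑₂-mono (λ d e → ⟦⟧≤ (E d e x) (λ p → meets⇒1≤cross (meets-sym (free⇒meets G free p xyz)))))
               (≤-reflexive (∑₂-cross y z))
  -- A pair meeting both ab and pq contains p, which gives a row and a column, or it contains q and,
  -- since q misses ab, has its other end in {a, b}, which gives four cells.
  cover : Fin n → Fin n → ℕ
  cover d e = (δ p d + δ p e) + (δ q d * pair a b e + pair a b d * δ q e)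
  ∑₂-cover : ∑₂ cover ≡ n + n + 4
  ∑₂-cover = trans (∑₂-+ (λ d e → δ p d + δ p e) (λ d e → δ q d * pair a b e + pair a b d * δ q e)) (cong₂ _+_
    (trans (∑₂-+ (λ d e → δ p d) (λ d e → δ p e)) (cong₂ _+_ (∑₂-row p) (∑₂-col p)))
    (trans (∑₂-+ (λ d e → δ q d * pair a b e) (λ d e → pair a b d * δ q e)) (cong₂ _+_
      (trans (∑₂-* (δ q) (pair a b)) (cong₂ _*_ (sum-δ q) (sum-pair a b)))
      (trans (∑₂-* (pair a b) (δ q)) (cong₂ _*_ (sum-pair a b) (sum-δ q))))))
  covered : ∀ d e → Meets a b d e → Meets p q d e → 1 ≤ cover d e
  covered d e _ (inj₁ (inj₁ d≡p)) = ≤-trans (≤-reflexive (sym (δ-≡ d≡p)))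
    (≤-trans (m≤m+n (δ p d) (δ p e)) (m≤m+n _ _))
  covered d e _ (inj₂ (inj₁ e≡p)) = ≤-trans (≤-reflexive (sym (δ-≡ e≡p)))
    (≤-trans (m≤n+m (δ p e) (δ p d)) (m≤m+n _ _))
  covered d e (inj₁ d∈) (inj₁ (inj₂ refl)) = contradiction d∈ q∉ab
  covered d e (inj₂ e∈) (inj₁ (inj₂ d≡q)) = ≤-trans
    (*-mono-≤ (≤-reflexive (sym (δ-≡ d≡q))) (∈₂⇒1≤pair e∈))
    (≤-trans (m≤m+n (δ q d * pair a b e) _) (m≤n+m _ (δ p d + δ p e)))
  covered d e (inj₂ e∈) (inj₂ (inj₂ refl)) = contradiction e∈ q∉ab
  covered d e (inj₁ d∈) (inj₂ (inj₂ e≡q)) = ≤-trans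
    (*-mono-≤ (∈₂⇒1≤pair d∈) (≤-reflexive (sym (δ-≡ e≡q))))
    (≤-trans (m≤n+m (pair a b d * δ q e) (δ q d * pair a b e)) (m≤n+m _ (δ p d + δ p e)))
  T≤ : T ≤ n + n + 4
  T≤ = ≤-trans (∑₂-mono (λ d e → ⟦⟧≤ (E x d e)
         (λ xde → covered d e (free⇒meets G free abx xde) (free⇒meets G free pqx xde))))
       (≤-reflexive ∑₂-cover)
  ten : ∀ n → (n + n + n) + (n + n + n) + 4 * n ≡ 2 * (5 * n)
  ten = solve-∀

-- These are the three possible edges on the triple {x, d, e}. Grouped in this way, tail and head
-- links share a single bound in the oriented case.
pairWeight : ∀ {n} → Raw n → Fin n → Fin n → Fin n → ℕ
pairWeight E x d e = ⟦ E x d e ⟧ + ⟦ E x e d ⟧ + ⟦ E d e x ⟧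

weight≡∑₂ : ∀ {n} (E : Raw n) x → weight E x ≡ ∑₂ (pairWeight E x)
weight≡∑₂ {n} E x = sym (begin
  ∑₂ (pairWeight E x)   ≡⟨ ∑₂-+ (λ d e → ⟦ E x d e ⟧ + ⟦ E x e d ⟧) (λ d e → ⟦ E d e x ⟧) ⟩
  ∑₂ (λ d e → ⟦ E x d e ⟧ + ⟦ E x e d ⟧) + headWeight E x
    ≡⟨ cong (_+ headWeight E x) (∑₂-+ (λ d e → ⟦ E x d e ⟧) (λ d e → ⟦ E x e d ⟧)) ⟩
  tailWeight E x + ∑₂ (λ d e → ⟦ E x e d ⟧) + headWeight E x
    ≡⟨ cong (λ s → tailWeight E x + s + headWeight E x) (∑-comm (λ d e → ⟦ E x e d ⟧)) ⟩
  weight E x            ∎)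
  where open ≡-Reasoning

-- Orientation lets at most one of the three indicators be 1, so each edge may be treated alone.
pairWeight-≤ : ∀ {n} {E : Raw n} → IsGraph E → Oriented E → ∀ x d e {m} →
  (E x d e ≡ true → 1 ≤ m) → (E x e d ≡ true → 1 ≤ m) → (E d e x ≡ true → 1 ≤ m) →
  pairWeight E x d e ≤ m
pairWeight-≤ {E = E} G orient x d e {m} p q r with E x d e in xde | E x e d in xed | E d e x in dex
... | false | false | false = z≤n
... | false | false | true  = r refl
... | false | true  | false = q refl
... | true  | false | false = p refl
... | true  | true  | _     = contradiction (trans (sym xed) (proj₁ (orient x d e xde))) λ ()
... | true  | false | true  = contradiction (trans (sym dex) (proj₂ (orient x d e xde))) λ ()
... | false | true  | true  = contradiction
  (trans (sym dex) (trans (IsGraph.tailSym G d e x) (proj₂ (orient x e d xed)))) λ ()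

-- The links of x cross-intersect, so two disjoint pairs in its head link, one through each
-- end of a tail pair yz, leave room for a single tail pair disjoint from {y, z}, namely bd.
-- The diagonal terms recover the slack needed to stay below 4n.
weight-disjoint : ∀ {n} {E : Raw n} → IsGraph E → Oriented E → Free R4 E →
  ∀ {x y b z d} → E y b x ≡ true → E z d x ≡ true → b ≢ d →
  (∀ u v → E u v x ≡ true → Meets y z u v) → weight E x ≤ 4 * n
weight-disjoint {n} {E} G orient free {x} {y} {b} {z} {d} ybx zdx b≢d heads =
  +-cancelʳ-≤ 2 _ _ (begin
    weight E x + 2                        ≡⟨ cong₂ _+_ (weight≡∑₂ E x) (sym ∑₂-diag) ⟩
    ∑₂ (pairWeight E x) + ∑₂ diag         ≡⟨ sym (∑₂-+ (pairWeight E x) diag) ⟩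
    ∑₂ (λ u v → pairWeight E x u v + diag u v)  ≤⟨ ∑₂-mono pointwise ⟩
    ∑₂ (λ u v → cross y z u v + extra u v) ≡⟨ ∑₂-+ (cross y z) extra ⟩
    ∑₂ (cross y z) + ∑₂ extra             ≡⟨ cong₂ _+_ (∑₂-cross y z) ∑₂-extra ⟩
    4 * n + 2                             ∎)
  where
  open ≤-Reasoning
  open IsGraph G
  diag extra : Fin n → Fin n → ℕ
  diag u v = δ y u * δ y v + δ z u * δ z v
  extra u v = δ b u * δ d v + δ d u * δ b v
  ∑₂-diag : ∑₂ diag ≡ 2
  ∑₂-diag = trans (∑₂-+ (λ u v → δ y u * δ y v) (λ u v → δ z u * δ z v))
                  (cong₂ _+_ (∑₂-cell y y) (∑₂-cell z z))
  ∑₂-extra : ∑₂ extra ≡ 2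
  ∑₂-extra = trans (∑₂-+ (λ u v → δ b u * δ d v) (λ u v → δ d u * δ b v))
                   (cong₂ _+_ (∑₂-cell b d) (∑₂-cell d b))
  via-cross : ∀ {u v} → Meets y z u v → 1 ≤ cross y z u v + extra u v
  via-cross m = ≤-trans (meets⇒1≤cross m) (m≤m+n _ _)
  covered : ∀ u v → Meets y b u v → Meets z d u v → 1 ≤ cross y z u v + extra u v
  covered u v (inj₁ (inj₁ u≡y)) _ = via-cross (inj₁ (inj₁ u≡y))
  covered u v (inj₂ (inj₁ v≡y)) _ = via-cross (inj₂ (inj₁ v≡y))
  covered u v _ (inj₁ (inj₁ u≡z)) = via-cross (inj₁ (inj₂ u≡z))
  covered u v _ (inj₂ (inj₁ v≡z)) = via-cross (inj₂ (inj₂ v≡z))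
  covered u v (inj₁ (inj₂ u≡b)) (inj₁ (inj₂ u≡d)) = contradiction (trans (sym u≡b) u≡d) b≢d
  covered u v (inj₂ (inj₂ v≡b)) (inj₂ (inj₂ v≡d)) = contradiction (trans (sym v≡b) v≡d) b≢d
  covered u v (inj₁ (inj₂ u≡b)) (inj₂ (inj₂ v≡d)) = ≤-trans
    (*-mono-≤ (≤-reflexive (sym (δ-≡ u≡b))) (≤-reflexive (sym (δ-≡ v≡d))))
    (≤-trans (m≤m+n (δ b u * δ d v) _) (m≤n+m _ (cross y z u v)))
  covered u v (inj₂ (inj₂ v≡b)) (inj₁ (inj₂ u≡d)) = ≤-trans
    (*-mono-≤ (≤-reflexive (sym (δ-≡ u≡d))) (≤-reflexive (sym (δ-≡ v≡b))))
    (≤-trans (m≤n+m (δ d u * δ b v) (δ b u * δ d v)) (m≤n+m _ (cross y z u v)))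
  δ*δ≤δ : ∀ (i j : Fin n) → δ i j * δ i j ≤ δ i j
  δ*δ≤δ i j = ≤-trans (*-monoʳ-≤ (δ i j) (⟦⟧≤1 (does (i ≟ᶠ j)))) (≤-reflexive (*-identityʳ (δ i j)))
  off-diag : ∀ i {u v : Fin n} → u ≢ v → δ i u * δ i v ≡ 0
  off-diag i {u} {v} u≢v with i ≟ᶠ u
  ... | no _ = refl
  ... | yes refl = trans (+-identityʳ (δ i v)) (δ-≢ u≢v)
  pointwise : ∀ u v → pairWeight E x u v + diag u v ≤ cross y z u v + extra u v
  pointwise u v with u ≟ᶠ v
  ... | yes refl = begin
    pairWeight E x u u + diag u u  ≤⟨ +-mono-≤ (pairWeight-≤ G orient x u u {0}
                                        (λ xuu → contradiction refl (proj₂ (proj₂ (distinct x u u xuu))))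
                                        (λ xuu → contradiction refl (proj₂ (proj₂ (distinct x u u xuu))))
                                        (λ uux → contradiction refl (proj₁ (distinct u u x uux))))
                                      (+-mono-≤ (δ*δ≤δ y u) (δ*δ≤δ z u)) ⟩
    pair y z u                     ≤⟨ m≤m+n (pair y z u) (pair y z u) ⟩
    cross y z u u                  ≤⟨ m≤m+n _ _ ⟩
    cross y z u u + extra u u      ∎
  ... | no u≢v = begin
    pairWeight E x u v + diag u v  ≡⟨ cong (pairWeight E x u v +_) (cong₂ _+_ (off-diag y u≢v) (off-diag z u≢v)) ⟩
    pairWeight E x u v + 0         ≡⟨ +-identityʳ _ ⟩
    pairWeight E x u v             ≤⟨ pairWeight-≤ G orient x u v
      (λ xuv → covered u v (free⇒meets G free ybx xuv) (free⇒meets G free zdx xuv))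
      (λ xvu → covered u v (swap (free⇒meets G free ybx xvu)) (swap (free⇒meets G free zdx xvu)))
      (λ uvx → via-cross (heads u v uvx)) ⟩
    cross y z u v + extra u v      ∎

-- If no head pair avoids ab, every pair in either link meets ab, and `cross` bounds everything by
-- 4n. If a head pair cd is disjoint from ab, the tail pair yz meets both and so has one end in
-- each; the opposite ends of the two head pairs are then the b and d of `weight-disjoint`.
weight-oriented : ∀ {n} {E : Raw n} → IsGraph E → Oriented E → Free R4 E →
                  ∀ x → IsHead E x → IsTail E x → weight E x ≤ 2 * (2 * n)
weight-oriented {n} {E} G orient free x (a , b , abx) (y , z , xyz) =
  ≤-trans (bounded (any? (λ c → any? (λ d → (E c d x ≟ᵇ true) ×-dec ¬? (meets? a b c d)))))
          (≤-reflexive (*-assoc 2 2 n))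
  where
  open IsGraph G
  heads : ∀ u v → E u v x ≡ true → Meets y z u v
  heads u v uvx = meets-sym (free⇒meets G free uvx xyz)
  partner : ∀ {a b y} → E a b x ≡ true → y ∈₂ (a , b) → ∃ λ b′ → E y b′ x ≡ true × (b′ ∈₂ (a , b))
  partner {a} {b} abx (inj₁ refl) = b , abx , inj₂ refl
  partner {a} {b} abx (inj₂ refl) = a , trans (tailSym b a x) abx , inj₁ refl
  bounded : Dec (∃ λ c → ∃ λ d → E c d x ≡ true × ¬ Meets a b c d) → weight E x ≤ 4 * n
  bounded (no none) = ≤-trans (≤-reflexive (weight≡∑₂ E x)) (≤-trans
    (∑₂-mono (λ u v → pairWeight-≤ G orient x u v
      (λ xuv → meets⇒1≤cross (free⇒meets G free abx xuv))
      (λ xvu → meets⇒1≤cross (swap (free⇒meets G free abx xvu)))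
      (λ uvx → meets⇒1≤cross (meeting u v uvx))))
    (≤-reflexive (∑₂-cross a b)))
    where
    meeting : ∀ u v → E u v x ≡ true → Meets a b u v
    meeting u v uvx with meets? a b u v
    ... | yes m = m
    ... | no ¬m = contradiction (u , v , uvx , ¬m) none
  bounded (yes (c , d , cdx , ¬m)) = split (free⇒meets G free abx xyz) (free⇒meets G free cdx xyz)
    where
    disjoint : ∀ {u v} → u ∈₂ (a , b) → v ∈₂ (c , d) → u ≢ v
    disjoint u∈ (inj₁ refl) refl = ¬m (inj₁ u∈)
    disjoint u∈ (inj₂ refl) refl = ¬m (inj₂ u∈)
    split : Meets a b y z → Meets c d y z → weight E x ≤ 4 * n
    split (inj₁ y∈ab) (inj₁ y∈cd) = contradiction refl (disjoint y∈ab y∈cd)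
    split (inj₂ z∈ab) (inj₂ z∈cd) = contradiction refl (disjoint z∈ab z∈cd)
    split (inj₁ y∈ab) (inj₂ z∈cd) with partner abx y∈ab | partner cdx z∈cd
    ... | b′ , yb′x , b′∈ | d′ , zd′x , d′∈ =
      weight-disjoint G orient free yb′x zd′x (disjoint b′∈ d′∈) heads
    split (inj₂ z∈ab) (inj₁ y∈cd) with partner cdx y∈cd | partner abx z∈ab
    ... | d′ , yd′x , d′∈ | b′ , zb′x , b′∈ =
      weight-disjoint G orient free yd′x zb′x (λ eq → disjoint b′∈ d′∈ (sym eq)) heads

-- Counting edges by vertex classes

head? : ∀ {n} (E : Raw n) x → Dec (IsHead E x)
head? E x = any? (λ a → any? (λ b → E a b x ≟ᵇ true))

tail? : ∀ {n} (E : Raw n) x → Dec (IsTail E x)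
tail? E x = any? (λ a → any? (λ b → E x a b ≟ᵇ true))

-- Isolated vertices count as nonHead.
nonHead pureHead mixed : ∀ {n} → Raw n → Fin n → Bool
nonHead E x = not (does (head? E x))
pureHead E x = does (head? E x) ∧ not (does (tail? E x))
mixed E x = does (head? E x) ∧ does (tail? E x)

count-classes : ∀ {n} (E : Raw n) → count (mixed E) + (count (pureHead E) + count (nonHead E)) ≡ n
count-classes {n} E = begin
  count (mixed E) + (count (pureHead E) + count (nonHead E))
    ≡⟨ cong (count (mixed E) +_) (sym (∑-distrib-+ (λ x → ⟦ pureHead E x ⟧) (λ x → ⟦ nonHead E x ⟧))) ⟩
  count (mixed E) + ∑[ x < n ] (⟦ pureHead E x ⟧ + ⟦ nonHead E x ⟧)
    ≡⟨ sym (∑-distrib-+ (λ x → ⟦ mixed E x ⟧) (λ x → ⟦ pureHead E x ⟧ + ⟦ nonHead E x ⟧)) ⟩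
  ∑[ x < n ] (⟦ mixed E x ⟧ + (⟦ pureHead E x ⟧ + ⟦ nonHead E x ⟧))
    ≡⟨ sum-cong-≗ (λ x → one (does (head? E x)) (does (tail? E x))) ⟩
  ∑[ x < n ] 1    ≡⟨ sum-const n 1 ⟩
  n * 1           ≡⟨ *-identityʳ n ⟩
  n               ∎
  where
  open ≡-Reasoning
  one : ∀ h t → ⟦ h ∧ t ⟧ + (⟦ h ∧ not t ⟧ + ⟦ not h ⟧) ≡ 1
  one true true = refl
  one true false = refl
  one false _ = refl

mixed⇒ : ∀ {n} (E : Raw n) x → mixed E x ≡ true → IsHead E x × IsTail E x
mixed⇒ E x eq with head? E x | tail? E x
... | yes h | yes t = h , t

-- The edge itself shows that a and b are tails and c is a head. If none of them is mixed, a and b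
-- are never heads and c is never a tail.
edge-classes : ∀ {n} {E : Raw n} → IsGraph E → ∀ a b c → E a b c ≡ true →
  (mixed E a ≡ true ⊎ mixed E b ≡ true ⊎ mixed E c ≡ true) ⊎ K (nonHead E) (pureHead E) a b c ≡ true
edge-classes {n} {E} G a b c abc
  rewrite dec-true (tail? E a) (b , c , abc)
        | dec-true (tail? E b) (a , c , trans (IsGraph.tailSym G b a c) abc)
        | dec-true (head? E c) (a , b , abc)
  with does (head? E a) | does (head? E b) | does (tail? E c) | a ≟ᶠ b
... | true  | _     | _     | _ = inj₁ (inj₁ refl)
... | false | true  | _     | _ = inj₁ (inj₂ (inj₁ refl))
... | false | false | true  | _ = inj₁ (inj₂ (inj₂ refl))
... | false | false | false | no _ = inj₂ refl
... | false | false | false | yes a≡b = contradiction a≡b (proj₁ (IsGraph.distinct G a b c abc))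

-- Every edge is charged to each mixed vertex on it; an edge without one belongs to `K`. Over
-- ordered triples a mixed x receives its tail weight twice, once per tail position, and its head
-- weight once, which adds up to `weight E x`.
edgeCount≤ : ∀ {n} {E : Raw n} → IsGraph E → ∀ c →
  (∀ x → IsHead E x → IsTail E x → weight E x ≤ 2 * c) →
  edgeCount E ≤ count (pureHead E) * (count (nonHead E) C 2) + count (mixed E) * c
edgeCount≤ {n} {E} G c light = *-cancelˡ-≤ 2 (begin
  2 * edgeCount E                  ≡⟨ sym (edgeCount-double E G) ⟩
  ∑₃ (λ a b c → e a b c)           ≤⟨ ∑₃-mono pointwise ⟩
  ∑₃ (λ a b c → k a b c + (μ a * e a b c + μ b * e a b c + μ c * e a b c))
    ≡⟨ ∑₃-+ k (λ a b c → μ a * e a b c + μ b * e a b c + μ c * e a b c) ⟩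
  ∑₃ k + ∑₃ (λ a b c → μ a * e a b c + μ b * e a b c + μ c * e a b c)
    ≡⟨ cong (∑₃ k +_) ∑₃-μ ⟩
  ∑₃ k + ∑[ x < n ] (μ x * weight E x)   ≤⟨ +-monoʳ-≤ (∑₃ k) (sum-mono mixed-light) ⟩
  ∑₃ k + ∑[ x < n ] (μ x * (2 * c))      ≡⟨ cong₂ _+_ (∑₃-K (nonHead E) (pureHead E)) (sum-*ʳ μ (2 * c)) ⟩
  2 * (count (pureHead E) * (count (nonHead E) C 2)) + count (mixed E) * (2 * c)
    ≡⟨ regroup (count (pureHead E) * (count (nonHead E) C 2)) (count (mixed E)) c ⟩
  2 * (count (pureHead E) * (count (nonHead E) C 2) + count (mixed E) * c)  ∎)
  where
  open ≤-Reasoning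
  regroup : ∀ p m c → 2 * p + m * (2 * c) ≡ 2 * (p + m * c)
  regroup = solve-∀
  μ : Fin n → ℕ
  μ x = ⟦ mixed E x ⟧
  e k : Fin n → Fin n → Fin n → ℕ
  e a b c = ⟦ E a b c ⟧
  k a b c = ⟦ K (nonHead E) (pureHead E) a b c ⟧
  mixed-light : ∀ x → μ x * weight E x ≤ μ x * (2 * c)
  mixed-light x with mixed E x in eq
  ... | false = z≤n
  ... | true = *-monoʳ-≤ 1 (light x (proj₁ (mixed⇒ E x eq)) (proj₂ (mixed⇒ E x eq)))
  one : ∀ {b} → b ≡ true → 1 ≤ ⟦ b ⟧ * 1
  one refl = ≤-refl
  one′ : ∀ {b} → b ≡ true → 1 ≤ ⟦ b ⟧
  one′ refl = ≤-refl
  pointwise : ∀ a b c → e a b c ≤ k a b c + (μ a * e a b c + μ b * e a b c + μ c * e a b c)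
  pointwise a b c with E a b c in abc
  ... | false = z≤n
  ... | true with edge-classes G a b c abc
  ...   | inj₂ kabc = ≤-trans (one′ kabc) (m≤m+n (k a b c) _)
  ...   | inj₁ (inj₁ ma) = ≤-trans (one ma)
    (≤-trans (m≤m+n (μ a * 1) (μ b * 1)) (≤-trans (m≤m+n _ (μ c * 1)) (m≤n+m _ (k a b c))))
  ...   | inj₁ (inj₂ (inj₁ mb)) = ≤-trans (one mb)
    (≤-trans (m≤n+m (μ b * 1) (μ a * 1)) (≤-trans (m≤m+n _ (μ c * 1)) (m≤n+m _ (k a b c))))
  ...   | inj₁ (inj₂ (inj₂ mc)) = ≤-trans (one mc)
    (≤-trans (m≤n+m (μ c * 1) (μ a * 1 + μ b * 1)) (m≤n+m _ (k a b c)))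
  factor : ∀ (f : Fin n → Fin n → Fin n → ℕ) → ∑₃ (λ x d e → μ x * f x d e) ≡ ∑[ x < n ] (μ x * ∑₂ (f x))
  factor f = sum-cong-≗ (λ x → trans (sum-cong-≗ (λ d → sum-*ˡ (μ x) (f x d))) (sum-*ˡ (μ x) (λ d → sum (f x d))))
  first : ∑₃ (λ a b c → μ a * e a b c) ≡ ∑[ x < n ] (μ x * tailWeight E x)
  first = factor e
  second : ∑₃ (λ a b c → μ b * e a b c) ≡ ∑[ x < n ] (μ x * tailWeight E x)
  second = trans (∑-comm (λ a b → ∑[ c < n ] (μ b * e a b c)))
    (trans (∑₃-cong (λ b a c → cong (λ s → μ b * ⟦ s ⟧) (IsGraph.tailSym G a b c))) (factor e))
  third : ∑₃ (λ a b c → μ c * e a b c) ≡ ∑[ x < n ] (μ x * headWeight E x)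
  third = trans (sum-cong-≗ (λ a → ∑-comm (λ b c → μ c * e a b c)))
    (trans (∑-comm (λ a c → ∑[ b < n ] (μ c * e a b c))) (factor (λ c a b → e a b c)))
  ∑₃-μ : ∑₃ (λ a b c → μ a * e a b c + μ b * e a b c + μ c * e a b c) ≡ ∑[ x < n ] (μ x * weight E x)
  ∑₃-μ = begin-equality
    ∑₃ (λ a b c → μ a * e a b c + μ b * e a b c + μ c * e a b c)
      ≡⟨ ∑₃-+ (λ a b c → μ a * e a b c + μ b * e a b c) (λ a b c → μ c * e a b c) ⟩
    ∑₃ (λ a b c → μ a * e a b c + μ b * e a b c) + ∑₃ (λ a b c → μ c * e a b c)
      ≡⟨ cong₂ _+_ (trans (∑₃-+ (λ a b c → μ a * e a b c) (λ a b c → μ b * e a b c)) (cong₂ _+_ first second)) third ⟩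
    ∑[ x < n ] (μ x * T x) + ∑[ x < n ] (μ x * T x) + ∑[ x < n ] (μ x * H x)
      ≡⟨ cong (_+ ∑[ x < n ] (μ x * H x)) (sym (∑-distrib-+ (λ x → μ x * T x) (λ x → μ x * T x))) ⟩
    ∑[ x < n ] (μ x * T x + μ x * T x) + ∑[ x < n ] (μ x * H x)
      ≡⟨ sym (∑-distrib-+ (λ x → μ x * T x + μ x * T x) (λ x → μ x * H x)) ⟩
    ∑[ x < n ] (μ x * T x + μ x * T x + μ x * H x)
      ≡⟨ sum-cong-≗ (λ x → collect (μ x) (T x) (H x)) ⟩
    ∑[ x < n ] (μ x * weight E x)  ∎
    where
    T H : Fin n → ℕ
    T = tailWeight E
    H = headWeight E
    collect : ∀ m t h → m * t + m * t + m * h ≡ m * (t + t + h)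
    collect = solve-∀

-- The extremal graphs and their isomorphisms

B : ∀ {n} → (Fin n → Bool) → Raw n
B τ = K τ (not ∘ τ)

B-true : ∀ {n} (τ : Fin n → Bool) {a b c} → B τ a b c ≡ true →
         τ a ≡ true × τ b ≡ true × a ≢ b × τ c ≡ false
B-true τ {a} {b} {c} abc with τ a | τ b | a ≟ᶠ b | τ c
... | true | true | no a≢b | false = refl , refl , a≢b , refl

true≢false : ∀ {b} → b ≡ true → b ≢ false
true≢false refl ()

B-graph : ∀ {n} (τ : Fin n → Bool) → IsGraph (B τ)
B-graph τ = record { distinct = distinct ; tailSym = tailSym }
  where
  distinct : ∀ a b c → B τ a b c ≡ true → a ≢ b × a ≢ c × b ≢ c
  distinct a b c abc with B-true τ abc
  ... | τa , τb , a≢b , τc = a≢b , (λ { refl → true≢false τa τc }) , (λ { refl → true≢false τb τc })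
  tailSym : ∀ a b c → B τ a b c ≡ B τ b a c
  tailSym a b c with a ≟ᶠ b | b ≟ᶠ a
  ... | yes refl | yes _ = refl
  ... | yes a≡b | no b≢a = contradiction (sym a≡b) b≢a
  ... | no a≢b | yes b≡a = contradiction (sym b≡a) a≢b
  ... | no _ | no _ with τ a | τ b
  ...   | true  | true  = refl
  ...   | true  | false = refl
  ...   | false | true  = refl
  ...   | false | false = refl

B-oriented : ∀ {n} (τ : Fin n → Bool) → Oriented (B τ)
B-oriented τ a b c abc = absent (λ acb → true≢false (proj₁ (proj₂ (B-true τ abc))) (proj₂ (proj₂ (proj₂ (B-true τ acb)))))
                       , absent (λ bca → true≢false (proj₁ (B-true τ abc)) (proj₂ (proj₂ (proj₂ (B-true τ bca)))))
  where
  absent : ∀ {b} → ¬ (b ≡ true) → b ≡ false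
  absent {true} ¬p = contradiction refl ¬p
  absent {false} _ = refl

-- Vertex 2 of `R4` is a head and also lies in a tail, so its image would be both outside and inside
-- `τ`.
B-free : ∀ {n} (τ : Fin n → Bool) → Free R4 (B τ)
B-free τ (φ , _ , hom) = true≢false (proj₁ (B-true τ (hom 2F 3F 4F refl)))
                                   (proj₂ (proj₂ (proj₂ (B-true τ (hom 0F 1F 2F refl)))))

B-edgeCount : ∀ {n} (τ : Fin n → Bool) → edgeCount (B τ) ≡ count (not ∘ τ) * (count τ C 2)
B-edgeCount τ = *-cancelˡ-≡ _ _ 2 (trans (sym (edgeCount-double (B τ) (B-graph τ))) (∑₃-K τ (not ∘ τ)))

B-iso : ∀ {n} (τ τ′ : Fin n → Bool) → count τ ≡ count τ′ → Iso (B τ) (B τ′)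
B-iso τ τ′ eq with equal-counts⇒permutation τ τ′ eq
... | π , agree = π , λ a b c → cong₂ _∧_
    (cong₂ _∧_ (agree a) (cong₂ (λ s t → s ∧ not t) (agree b) (same a b)))
    (cong not (agree c))
  where
  same : ∀ a b → does (a ≟ᶠ b) ≡ does ((π ⟨$⟩ʳ a) ≟ᶠ (π ⟨$⟩ʳ b))
  same a b with a ≟ᶠ b | (π ⟨$⟩ʳ a) ≟ᶠ (π ⟨$⟩ʳ b)
  ... | yes _ | yes _ = refl
  ... | no _ | no _ = refl
  ... | yes refl | no πa≢πa = contradiction refl πa≢πa
  ... | no a≢b | yes πa≡πb = contradiction (Injection.injective (↔⇒↣ π) πa≡πb) a≢b

below : ∀ {n} → ℕ → Fin n → Bool
below t i = toℕ i <ᵇ t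

count-not-below : ∀ {n} h t → h + t ≡ n → count {n} (not ∘ below t) ≡ h
count-not-below {n} h t eq = +-cancelˡ-≡ (count {n} (below t)) _ _ (begin
  count {n} (below t) + count {n} (not ∘ below t)  ≡⟨ count-not {n} (below t) ⟩
  n                            ≡⟨ sym eq ⟩
  h + t                        ≡⟨ +-comm h t ⟩
  t + h                        ≡⟨ cong (_+ h) (sym (count-below t (subst (t ≤_) eq (m≤n+m t h)))) ⟩
  count {n} (below t) + h          ∎)
  where open ≡-Reasoning

below-edgeCount : ∀ {n} h t → h + t ≡ n → edgeCount (B {n} (below t)) ≡ h * (t C 2)
below-edgeCount {n} h t eq = trans (B-edgeCount {n} (below t))
  (cong₂ (λ x y → x * (y C 2)) (count-not-below h t eq) (count-below t (subst (t ≤_) eq (m≤n+m t h))))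

-- Isomorphisms carry heads to heads. As two vertices lie below t, every vertex from t on is a head,
-- and these are too many for the other graph.
¬B-iso : ∀ {n} t t′ → 2 ≤ n → 2 ≤ t → count {n} (not ∘ below t′) < count {n} (not ∘ below t) →
         ¬ Iso (B {n} (below t)) (B (below t′))
¬B-iso t t′ (s≤s (s≤s z≤n)) (s≤s (s≤s z≤n)) fewer (σ , iso) = <⇒≱ fewer (≤-trans (sum-mono head-preserved)
  (≤-reflexive (sym (sum-permute (λ x → ⟦ not (below t′ x) ⟧) σ))))
  where
  head-preserved : ∀ c → ⟦ not (below t c) ⟧ ≤ ⟦ not (below t′ (σ ⟨$⟩ʳ c)) ⟧
  -- Both `0F` and `1F` lie below t, so the presence of the edge from them to c computes to
  -- `c-head`.
  head-preserved c = ⟦⟧≤ _ λ c-head → ≤-reflexive (cong (λ b → ⟦ not b ⟧)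
    (sym (proj₂ (proj₂ (proj₂ (B-true (below t′) {σ ⟨$⟩ʳ 0F} {σ ⟨$⟩ʳ 1F} {σ ⟨$⟩ʳ c}
      (trans (sym (iso 0F 1F c)) c-head)))))))

-- Upper bound and the case of equality

module Stability {n : ℕ} {E : Raw n} (G : IsGraph E) (c : ℕ)
  (light : (x : Fin n) → IsHead E x → IsTail E x → weight E x ≤ 2 * c)
  (c<Δ : c < Δ (pred n)) (linear< : n * c < bound n) where

  private
    t h m : ℕ
    t = count (nonHead E)
    h = count (pureHead E)
    m = count (mixed E)

  gap : ∀ m j → m + j ≡ n → 0 < m → bound j + m * c < bound n
  gap (suc m) j refl _ = bound-gap c m j c<Δ linear<

  mixed⇒below : 0 < m → edgeCount E < bound n
  mixed⇒below 0<m = begin-strict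
    edgeCount E            ≤⟨ edgeCount≤ G c light ⟩
    h * (t C 2) + m * c    ≤⟨ +-monoˡ-≤ (m * c) (h*C2≤bound h t) ⟩
    bound (h + t) + m * c  <⟨ gap m (h + t) (count-classes E) 0<m ⟩
    bound n                ∎
    where open ≤-Reasoning

  unmixed⇒≤ : m ≡ 0 → edgeCount E ≤ h * (t C 2)
  unmixed⇒≤ m≡0 = ≤-trans (edgeCount≤ G c light)
    (≤-reflexive (trans (cong (λ z → h * (t C 2) + z * c) m≡0) (+-identityʳ _)))

  h*C2≤ : m ≡ 0 → h * (t C 2) ≤ bound n
  h*C2≤ m≡0 = subst (λ z → h * (t C 2) ≤ bound z) (trans (cong (_+ (h + t)) (sym m≡0)) (count-classes E)) (h*C2≤bound h t)

  upper : edgeCount E ≤ bound n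
  upper with n≡0⊎0<n m
    where
    n≡0⊎0<n : ∀ k → k ≡ 0 ⊎ 0 < k
    n≡0⊎0<n zero = inj₁ refl
    n≡0⊎0<n (suc k) = inj₂ (s≤s z≤n)
  ... | inj₁ m≡0 = ≤-trans (unmixed⇒≤ m≡0) (h*C2≤ m≡0)
  ... | inj₂ 0<m = <⇒≤ (mixed⇒below 0<m)

  -- Equality excludes mixed vertices, so `E` is contained in `K` with the same total and agrees
  -- with it entrywise. Pure heads are then the complement of non-heads, which makes `K` a `B`.
  structure : edgeCount E ≡ bound n →
    ∃ λ τ → (∀ a b c → E a b c ≡ B τ a b c) × count (not ∘ τ) * (count τ C 2) ≡ bound n
  structure max = nonHead E , E≡B ,
    trans (cong (λ z → z * (t C 2)) (sum-cong-≗ (λ x → cong ⟦_⟧ (sym (pureHead≡ x))))) h*C2≡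
    where
    m≡0 : m ≡ 0
    m≡0 = n≤0⇒n≡0 (≮⇒≥ (λ 0<m → <⇒≢ (mixed⇒below 0<m) max))
    h*C2≡ : h * (t C 2) ≡ bound n
    h*C2≡ = ≤-antisym (h*C2≤ m≡0) (subst (_≤ h * (t C 2)) max (unmixed⇒≤ m≡0))
    unmixed : ∀ x → mixed E x ≡ false
    -- Comparison with the zero function: a vanishing sum has only vanishing terms.
    unmixed x = ⟦⟧-injective (sym (sum-tight {f = λ _ → 0} (λ _ → z≤n) (≤-trans (≤-reflexive m≡0) z≤n) x))
    pureHead≡ : ∀ x → pureHead E x ≡ not (nonHead E x)
    pureHead≡ x = boolean (does (head? E x)) (does (tail? E x)) (unmixed x)
      where
      boolean : ∀ h t → h ∧ t ≡ false → h ∧ not t ≡ not (not h)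
      boolean true false _ = refl
      boolean false _ _ = refl
    E≤K : ∀ a b c → ⟦ E a b c ⟧ ≤ ⟦ K (nonHead E) (pureHead E) a b c ⟧
    E≤K a b c = ⟦⟧≤ (E a b c) λ abc → present (edge-classes G a b c abc)
      where
      present : (mixed E a ≡ true ⊎ mixed E b ≡ true ⊎ mixed E c ≡ true) ⊎ K (nonHead E) (pureHead E) a b c ≡ true →
                1 ≤ ⟦ K (nonHead E) (pureHead E) a b c ⟧
      present (inj₂ k) = ≤-reflexive (cong ⟦_⟧ (sym k))
      present (inj₁ (inj₁ ma)) = contradiction (unmixed a) (true≢false ma)
      present (inj₁ (inj₂ (inj₁ mb))) = contradiction (unmixed b) (true≢false mb)
      present (inj₁ (inj₂ (inj₂ mc))) = contradiction (unmixed c) (true≢false mc)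
    E≡B : ∀ a b c → E a b c ≡ B (nonHead E) a b c
    E≡B a b c = trans (⟦⟧-injective (∑₃-tight E≤K tight a b c))
                      (cong (_ ∧_) (pureHead≡ c))
      where
      tight : ∑₃ (λ a b c → ⟦ K (nonHead E) (pureHead E) a b c ⟧) ≤ ∑₃ (λ a b c → ⟦ E a b c ⟧)
      tight = ≤-reflexive (trans (∑₃-K (nonHead E) (pureHead E))
        (trans (cong (2 *_) (trans h*C2≡ (sym max))) (sym (edgeCount-double E G))))

-- Exact value and classification of the extremal graphs

extremal-result : ∀ n (P : Raw n → Set) → 29 ≤ n →
  (∀ E → P E → edgeCount E ≤ bound n) →
  (∀ E → P E → edgeCount E ≡ bound n →
    ∃ λ τ → (∀ a b c → E a b c ≡ B τ a b c) × count (not ∘ τ) * (count τ C 2) ≡ bound n) →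
  (∀ τ → P (B τ)) → ExtremalResult n P
extremal-result n P 29≤n upper structure P-B = by-residue (mod3 n) refl
  where
  Optimal : ℕ → ℕ → Set
  Optimal h t = h + t ≡ n × h * (t C 2) ≡ bound n

  extremal : ∀ h t → Optimal h t → Extremal P (bound n) (B (below t))
  extremal h t (eq , max) = P-B (below t) , trans (below-edgeCount h t eq) max

  extremal-number : ∀ h t → Optimal h t → IsExtremalNumber P (bound n)
  extremal-number h t opt = (B (below t) , extremal h t opt) , upper

  iso-canonical : ∀ h t → h + t ≡ n → ∀ H τ → (∀ a b c → H a b c ≡ B τ a b c) →
                  count (not ∘ τ) ≡ h → Iso (B (below t)) H
  iso-canonical h t eq H τ H≡B h≡ with B-iso (below t) τ count≡
    where
    count≡ : count {n} (below t) ≡ count τ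
    count≡ = +-cancelʳ-≡ h _ _ (trans (cong (count {n} (below t) +_) (sym (count-not-below h t eq)))
      (trans (count-not {n} (below t)) (trans (sym (count-not τ)) (cong (count τ +_) h≡))))
  ... | σ , iso = σ , λ a b c → trans (iso a b c) (sym (H≡B _ _ _))

  total : ∀ (τ : Fin n → Bool) → count (not ∘ τ) + count τ ≡ n
  total τ = trans (+-comm (count (not ∘ τ)) (count τ)) (count-not τ)

  unique : ∀ k t → Optimal k t → 2 * k ≤ t → t ≤ suc (2 * k) → 2 ≤ t → UniqueUpToIso (Extremal P (bound n))
  unique k t (eq , max) p q 2≤t = B (below t) , extremal k t (eq , max) , canonical
    where
    canonical : ∀ H → Extremal P (bound n) H → Iso (B (below t)) H
    canonical H (PH , maxH) with structure H PH maxH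
    ... | τ , H≡B , maxτ = iso-canonical k t eq H τ H≡B
      (optimum-unique (count (not ∘ τ)) (count τ) k t (trans (total τ) (sym eq)) p q 2≤t (trans maxτ (sym max)))

  single : ∀ r k t → r < 2 → n ≡ r + 3 * k → Optimal k t → 2 * k ≤ t → t ≤ suc (2 * k) → 2 ≤ t → ExtremalResult n P
  single r k t r<2 n≡ opt p q 2≤t = extremal-number k t opt , (λ _ → unique k t opt p q 2≤t) ,
    (λ n%3≡2 → contradiction (trans (sym n%3≡2) (trans (cong (_% 3) n≡) (%3 r k (m<n⇒m<1+n r<2))))
      (λ 2≡r → <⇒≢ r<2 (sym 2≡r)))

  2≤2* : ∀ k → 0 < k → 2 ≤ 2 * k
  2≤2* k 0<k = *-monoʳ-≤ 2 0<k

  positive : ∀ r k → r < 3 → n ≡ r + 3 * k → 0 < k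
  positive r (suc k) _ _ = s≤s z≤n
  positive r zero r<3 n≡ = contradiction
    (≤-trans 29≤n (≤-trans (≤-reflexive (trans n≡ (+-identityʳ r))) (<⇒≤ r<3)))
    λ { (s≤s (s≤s (s≤s ()))) }

  by-residue : ∀ {n′} → Mod3 n′ → n ≡ n′ → ExtremalResult n P
  by-residue (0mod3 k) n≡ = single 0 k (2 * k) (s≤s z≤n) n≡
    (trans (three k) (sym n≡) , trans (sym (bound-0 k)) (cong bound (sym n≡)))
    ≤-refl (n≤1+n _) (2≤2* k (positive 0 k (s≤s z≤n) n≡))
    where
    three : ∀ k → k + 2 * k ≡ 3 * k
    three = solve-∀
  by-residue (1mod3 k) n≡ = single 1 k (suc (2 * k)) (s≤s (s≤s z≤n)) n≡
    (trans (three k) (sym n≡) , trans (sym (bound-1 k)) (cong bound (sym n≡)))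
    (n≤1+n _) ≤-refl (m≤n⇒m≤1+n (2≤2* k (positive 1 k (s≤s (s≤s z≤n)) n≡)))
    where
    three : ∀ k → k + suc (2 * k) ≡ 1 + 3 * k
    three = solve-∀
  by-residue (2mod3 k) n≡ = extremal-number k t₂ opt₂ ,
    (λ n%3≢2 → contradiction (trans (cong (_% 3) n≡) (%3 2 k ≤-refl)) n%3≢2) ,
    -- The tied sizes with k + 1 and with k heads give the two graphs; the number of heads tells
    -- them apart.
    λ _ → B (below t₁) , B (below t₂) , extremal (suc k) t₁ opt₁ , extremal k t₂ opt₂ , distinct , classify
    where
    t₁ t₂ : ℕ
    t₁ = suc (2 * k)
    t₂ = 2 + 2 * k
    0<k : 0 < k
    0<k = positive 2 k ≤-refl n≡
    three₁ : ∀ k → suc k + suc (2 * k) ≡ 2 + 3 * k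
    three₁ = solve-∀
    three₂ : ∀ k → k + (2 + 2 * k) ≡ 2 + 3 * k
    three₂ = solve-∀
    opt₂ : Optimal k t₂
    opt₂ = trans (three₂ k) (sym n≡) , trans (sym (bound-2 k)) (cong bound (sym n≡))
    opt₁ : Optimal (suc k) t₁
    opt₁ = trans (three₁ k) (sym n≡) , trans (tie k) (proj₂ opt₂)
    distinct : ¬ Iso (B {n} (below t₁)) (B (below t₂))
    distinct = ¬B-iso t₁ t₂ (≤-trans (m≤n+m 2 27) 29≤n) (s≤s (≤-trans 0<k (m≤m+n k _)))
      (subst₂ _<_ (sym (count-not-below k t₂ (proj₁ opt₂)))
                  (sym (count-not-below (suc k) t₁ (proj₁ opt₁))) ≤-refl)
    classify : ∀ H → Extremal P (bound n) H → Iso (B (below t₁)) H ⊎ Iso (B (below t₂)) H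
    classify H (PH , maxH) with structure H PH maxH
    ... | τ , H≡B , maxτ with optimum-two (count (not ∘ τ)) (count τ) k 0<k (trans (total τ) n≡)
                               (trans maxτ (sym (proj₂ opt₂)))
    ...   | inj₁ h≡k = inj₂ (iso-canonical k t₂ (proj₁ opt₂) H τ H≡B h≡k)
    ...   | inj₂ h≡1+k = inj₁ (iso-canonical (suc k) t₁ (proj₁ opt₁) H τ H≡B h≡1+k)

oriented-case : ∀ n → 29 ≤ n → ExtremalResult n (R4FreeOriented n)
oriented-case n 29≤n = extremal-result n (R4FreeOriented n) 29≤n
  (λ E (G , orient , free) → Stability.upper G (2 * n) (weight-oriented G orient free) c<Δ linear<)
  (λ E (G , orient , free) → Stability.structure G (2 * n) (weight-oriented G orient free) c<Δ linear<)
  (λ τ → B-graph τ , B-oriented τ , B-free τ)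
  where
  linear< = 2n²<bound n 29≤n
  c<Δ : 2 * n < Δ (pred n)
  -- The inequality for 5n is reused, as 2n ≤ 5n.
  c<Δ = ≤-<-trans (*-monoˡ-≤ n {2} {5} (s≤s (s≤s z≤n))) (5n<Δ-pred n 29≤n)

standard-case : ∀ n → 70 ≤ n → ExtremalResult n (R4FreeGraph n)
standard-case n 70≤n = extremal-result n (R4FreeGraph n) 29≤n
  (λ E (G , free) → Stability.upper G (5 * n) (weight-standard G free 4≤n) c<Δ linear<)
  (λ E (G , free) → Stability.structure G (5 * n) (weight-standard G free 4≤n) c<Δ linear<)
  (λ τ → B-graph τ , B-free τ)
  where
  29≤n : 29 ≤ n
  29≤n = ≤-trans (m≤n+m 29 41) 70≤n
  4≤n : 4 ≤ n
  4≤n = ≤-trans (m≤n+m 4 66) 70≤n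
  linear< = 5n²<bound n 70≤n
  c<Δ : 5 * n < Δ (pred n)
  c<Δ = 5n<Δ-pred n 29≤n

theorem1 : ((n : ℕ) → 29 ≤ n → ExtremalResult n (R4FreeOriented n))
    × ((n : ℕ) → 70 ≤ n → ExtremalResult n (R4FreeGraph n))
theorem1 = oriented-case , standard-case
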